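{- Let $G$ be a finite, simple cactus graph. Then $$\mathrm{Sz}(G) \leq 2\, W(G),$$ with equality if and only if every block of $G$ is a cycle of even length.
   Context: A cactus graph is a connected graph in which every two distinct cycles have at most one common vertex; alternatively, it is a connected graph that consists of a single vertex, or in which every block is either an edge or a cycle. A block is a maximal 2-connected subgraph in the sense of the block-cut-vertex decomposition, in which blocks only overlap at cut vertices; a block may consist of a single edge with its two end points. $V(G)$ and $E(G)$ are the vertex and edge sets of $G$; $d_G(u,v)$ is the length of a shortest path between $u$ and $v$ in $G$. The Wiener index is $$W(G) = \sum_{\{u,v\} \subseteq V(G)} d_G(u,v) = \tfrac12 \sum_{u,v \in V(G)} d_G(u,v).$$ For vertices $s,t$, $n_G(s,t)$ is the number of vertices $w$ of $G$ that are closer to $s$ than to $t$, i.e. with $d_G(w,s) < d_G(w,t)$. The Szeged index is $$\mathrm{Sz}(G) = \sum_{\{s,t\} \in E(G)} n_G(s,t)\, n_G(t,s).$$ -}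

module Defs where

open import Data.Bool.Base using (if_then_else_)
open import Data.Fin.Base using (Fin; toℕ)
open import Data.Fin.Properties using (_≟_; _<?_; any?)
open import Data.Fin.Subset using (Subset; _∈_; _⊆_; Nonempty; ⊤; ∣_∣; _-_)
open import Data.Fin.Subset.Properties using (∈⊤; x∈p∧x≢y⇒x∈p-y)
open import Data.Nat.Base using (ℕ; zero; suc; _*_; _≤_)
open import Data.Nat.Divisibility using (_∣_)
import Data.Nat.Properties as ℕ
open import Data.Product.Base using (∃; ∃₂; _×_; _,_)
open import Data.Sum.Base using (_⊎_)
open import Function.Bundles using (_⇔_)
open import Function.Definitions using (Injective)
open import Level using (0ℓ)
open import Relation.Binary.Core using (Rel)
open import Relation.Binary.Definitions using (Decidable; Irreflexive; Symmetric)
open import Relation.Binary.PropositionalEquality using (_≡_; _≢_)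
open import Relation.Nullary using (Dec; does; ¬?)
open import Relation.Nullary.Decidable using (_×-dec_)
import Relation.Unary as U

open import Algebra.Properties.Semiring.Sum ℕ.+-*-semiring using (sum-syntax)

-- Iverson bracket.
𝟙 : ∀ {a} {A : Set a} → Dec A → ℕ
𝟙 a? = if does a? then 1 else 0

record Graph (n : ℕ) : Set₁ where
  field
    Adj        : Rel (Fin n) 0ℓ
    adj?       : Decidable Adj
    adj-sym    : Symmetric Adj
    adj-irrefl : Irreflexive _≡_ Adj

Walk : ∀ {n} → Rel (Fin n) 0ℓ → ℕ → Rel (Fin n) 0ℓ
Walk R zero    u v = u ≡ v
Walk R (suc k) u v = ∃ λ w → R u w × Walk R k w v

walk? : ∀ {n} {R : Rel (Fin n) 0ℓ} → Decidable R → ∀ k → Decidable (Walk R k)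
walk? R? zero    u v = u ≟ v
walk? R? (suc k) u v = any? λ w → R? u w ×-dec walk? R? k w v

-- The least k < b satisfying P, and b itself if there is none.
least : {P : ℕ → Set} → U.Decidable P → ℕ → ℕ
least P? zero    = zero
least P? (suc b) = if does (P? zero) then zero else suc (least (λ k → P? (suc k)) b)

module _ {n : ℕ} (G : Graph n) where
  open Graph G

  -- A shortest walk is a path, so in a connected graph its length is less
  -- than n and the default value n is not taken.
  dist : Fin n → Fin n → ℕ
  dist u v = least (λ k → walk? adj? k u v) n

  -- In W and Sz an unordered pair is represented by its increasing ordering.
  W : ℕ
  W = ∑[ u < n ] ∑[ v < n ] (𝟙 (u <? v) * dist u v)

  closer : Fin n → Fin n → ℕ
  closer s t = ∑[ w < n ] 𝟙 (dist w s ℕ.<? dist w t)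

  Sz : ℕ
  Sz = ∑[ s < n ] ∑[ t < n ] (𝟙 (s <? t ×-dec adj? s t) * (closer s t * closer t s))

-- Subgraphs need not be induced.
record Subgraph {n : ℕ} (G : Graph n) : Set₁ where
  open Graph G
  field
    V     : Subset n
    E     : Rel (Fin n) 0ℓ
    E?    : Decidable E
    E-sym : Symmetric E
    E⊆Adj : ∀ {u v} → E u v → Adj u v
    E⇒∈   : ∀ {u v} → E u v → u ∈ V

module _ {n : ℕ} {G : Graph n} where
  open Subgraph

  infix 4 _⊑_

  _⊑_ : Rel (Subgraph G) 0ℓ
  H ⊑ K = V H ⊆ V K × (∀ {u v} → E H u v → E K u v)

  infixl 5 _∖_

  _∖_ : Subgraph G → Fin n → Subgraph G
  H ∖ x = record
    { V     = V H - x
    ; E     = λ u v → E H u v × u ≢ x × v ≢ x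
    ; E?    = λ u v → E? H u v ×-dec ¬? (u ≟ x) ×-dec ¬? (v ≟ x)
    ; E-sym = λ (e , u≢x , v≢x) → E-sym H e , v≢x , u≢x
    ; E⊆Adj = λ (e , _) → E⊆Adj H e
    ; E⇒∈   = λ (e , u≢x , _) → x∈p∧x≢y⇒x∈p-y (E⇒∈ H e) u≢x
    }

  Connected : Subgraph G → Set
  Connected H = Nonempty (V H) ×
    (∀ {u v} → u ∈ V H → v ∈ V H → ∃ λ k → Walk (E H) k u v)

  -- 2-connected in the sense of the block decomposition: a single edge with
  -- its end points qualifies, a single vertex does not.
  TwoConnected : Subgraph G → Set
  TwoConnected H = 2 ≤ ∣ V H ∣ × Connected H × (∀ {x} → x ∈ V H → Connected (H ∖ x))

  IsBlock : Subgraph G → Set₁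
  IsBlock B = TwoConnected B × (∀ H → TwoConnected H → B ⊑ H → H ⊑ B)

  IsEdge : Subgraph G → Set
  IsEdge H = ∃₂ λ u v → E H u v × (∀ {w} → w ∈ V H → w ≡ u ⊎ w ≡ v)

-- j is the cyclic successor of i.
Next : ∀ {k} → Rel (Fin k) 0ℓ
Next {k} i j = suc (toℕ i) ≡ toℕ j ⊎ (suc (toℕ i) ≡ k × toℕ j ≡ 0)

record IsCycle {n : ℕ} {G : Graph n} (H : Subgraph G) (k : ℕ) : Set where
  open Subgraph H
  field
    3≤k       : 3 ≤ k
    vertex    : Fin k → Fin n
    injective : Injective _≡_ _≡_ vertex
    vertices  : ∀ {v} → v ∈ V ⇔ ∃ λ i → vertex i ≡ v
    edges     : ∀ {u v} → E u v ⇔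
                  ∃₂ λ i j → (Next i j ⊎ Next j i) × vertex i ≡ u × vertex j ≡ v

module _ {n : ℕ} (G : Graph n) where
  open Graph G

  whole : Subgraph G
  whole = record
    { V = ⊤ ; E = Adj ; E? = adj? ; E-sym = adj-sym
    ; E⊆Adj = λ e → e ; E⇒∈ = λ _ → ∈⊤ }

  Cactus : Set₁
  Cactus = Connected whole ×
    (n ≡ 1 ⊎ (∀ (B : Subgraph G) → IsBlock B → IsEdge B ⊎ ∃ λ k → IsCycle B k))

IsEvenCycle : ∀ {n} {G : Graph n} → Subgraph G → Set
IsEvenCycle H = ∃ λ k → IsCycle H k × 2 ∣ k

{-# OPTIONS --safe #-}
module Submission where

-- Write Sz as the number of triples of a pair {x , y} and an edge st such that x is closer to s
-- and y closer to t; it is enough to compare, for each pair, the number sep x y of its separating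
-- edges with 2 d(x , y).  Twice sep x y is at most the variation Σ Δ x y s t over the edges st,
-- which is subadditive along a geodesic.  For an edge pq the variation is at most 4: an edge st
-- other than pq that is not level with respect to p and q closes up, with geodesics from p to s
-- and from t to q, to a cycle through pq along which the position H relative to pq falls
-- monotonically; in a cactus there is only one cycle through pq, so all such edges lie on it.
-- For a separating edge st ≠ pq of the pair p, q this cycle has the even length 2 d(p , s) + 2,
-- which gives one half of the equality case.  Conversely, on an even cycle block a parity count
-- shows that exactly one edge besides pq is not level, and that it separates p and q; then no
-- such pair of edges can be crossed back by a geodesic, and sep grows by at least 2 per step.

open import Defs
open import Data.Empty using (⊥; ⊥-elim)
open import Data.Fin.Base as Fin using (Fin; zero; suc; toℕ; fromℕ<)
open import Data.Fin.Properties as Fin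
  using (_≟_; _<?_; any?; pigeonhole; toℕ<n; toℕ-fromℕ<; toℕ-injective; injective⇒≤)
open import Data.Fin.Subset
  using (Subset; _∈_; _∉_; _⊆_; ∣_∣; _-_; _∪_; ⁅_⁆; inside; outside)
open import Data.Fin.Subset.Properties
  using (_∈?_; x∈p∧x≢y⇒x∈p-y; p⊆q⇒∣p∣≤∣q∣; x∈p⇒∣p-x∣<∣p∣; p⊂q⇒∣p∣<∣q∣;
         p─q⊆p; x∈p∪q⁺; x∈p∪q⁻; x∈⁅x⁆; x∈⁅y⁆⇒x≡y; ∣p∣≤n; ∈⊤)
open import Data.Nat.Base
open import Data.Nat.Divisibility using (_∣_; divides; ∣m+n∣m⇒∣n; ∣-refl; >⇒∤)
open import Data.Nat.Induction using (<-rec)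
open import Data.Nat.Properties as ℕ hiding (_≟_; _<?_)
open import Data.Nat.Tactic.RingSolver using (solve-∀)
open import Data.Product.Base using (∃; ∃₂; _×_; _,_; proj₁; proj₂)
open import Data.Product.Properties using (,-injectiveˡ; ,-injectiveʳ; ≡-dec)
open import Data.Sum.Base using (_⊎_; inj₁; inj₂; [_,_]′; swap)
open import Data.Vec.Base using (_∷_; there; tabulate)
open import Data.Vec.Properties using (lookup∘tabulate; []=⇒lookup; lookup⇒[]=)
open import Function.Base using (_∘_; case_of_; id)
open import Function.Bundles using (_⇔_; mk⇔; Equivalence)
open import Level using (0ℓ)
open import Relation.Binary.Core using (Rel)
open import Relation.Binary.Definitions using (Symmetric; tri<; tri≈; tri>)
open import Relation.Binary.PropositionalEquality
open import Relation.Nullary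
open import Relation.Nullary.Decidable using (dec-true; _×-dec_; _⊎-dec_; decidable-stable)
import Relation.Unary as U

open import Algebra.Properties.Semiring.Sum ℕ.+-*-semiring

private variable
  m n : ℕ

-- Finite sums

∑-mono-≤ : {f g : Fin n → ℕ} → (∀ i → f i ≤ g i) → sum f ≤ sum g
∑-mono-≤ {zero}  f≤g = z≤n
∑-mono-≤ {suc n} f≤g = +-mono-≤ (f≤g zero) (∑-mono-≤ (f≤g ∘ suc))

+-mono-≤-equality : ∀ {a b c d} → a ≤ c → b ≤ d → a + b ≡ c + d → a ≡ c × b ≡ d
+-mono-≤-equality {a} {b} {c} {d} a≤c b≤d eq =
  ≤-antisym a≤c (+-cancelʳ-≤ d c a (≤-trans (≤-reflexive (sym eq)) (+-monoʳ-≤ a b≤d))) ,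
  ≤-antisym b≤d (+-cancelˡ-≤ c d b (≤-trans (≤-reflexive (sym eq)) (+-monoˡ-≤ b a≤c)))

∑-mono-≤-equality : {f g : Fin n → ℕ} → (∀ i → f i ≤ g i) → sum f ≡ sum g → ∀ i → f i ≡ g i
∑-mono-≤-equality {suc n} f≤g eq zero =
  proj₁ (+-mono-≤-equality (f≤g zero) (∑-mono-≤ (f≤g ∘ suc)) eq)
∑-mono-≤-equality {suc n} f≤g eq (suc i) =
  ∑-mono-≤-equality (f≤g ∘ suc) (proj₂ (+-mono-≤-equality (f≤g zero) (∑-mono-≤ (f≤g ∘ suc)) eq)) i

term≤∑ : (f : Fin n → ℕ) → ∀ i → f i ≤ sum f
term≤∑ f zero    = m≤m+n _ _
term≤∑ f (suc i) = ≤-trans (term≤∑ (f ∘ suc) i) (m≤n+m _ _)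

∑-𝟙 : (a : Fin n) (f : Fin n → ℕ) → ∑[ i < n ] (𝟙 (a ≟ i) * f i) ≡ f a
∑-𝟙 {suc n} zero    f =
  trans (cong₂ _+_ (+-identityʳ (f zero)) (sum-replicate-zero n)) (+-identityʳ (f zero))
∑-𝟙 {suc n} (suc a) f = ∑-𝟙 a (f ∘ suc)

∑∑-𝟙 : (a b : Fin n) (F : Fin n → Fin n → ℕ) →
  ∑[ s < n ] ∑[ t < n ] (𝟙 (a ≟ s) * (𝟙 (b ≟ t) * F s t)) ≡ F a b
∑∑-𝟙 {n} a b F = trans
  (sum-cong-≗ λ s → trans (sym (*-distribˡ-sum (𝟙 (a ≟ s)) (λ t → 𝟙 (b ≟ t) * F s t)))
                          (cong (𝟙 (a ≟ s) *_) (∑-𝟙 b (F s))))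
  (∑-𝟙 a (λ s → F s b))

𝟙-yes : ∀ {A : Set} (a? : Dec A) → A → 𝟙 a? ≡ 1
𝟙-yes (yes _) a = refl
𝟙-yes (no ¬a) a = contradiction a ¬a

𝟙-no : ∀ {A : Set} (a? : Dec A) → ¬ A → 𝟙 a? ≡ 0
𝟙-no (yes a) ¬a = contradiction a ¬a
𝟙-no (no _)  ¬a = refl

-- Each `F s t` is dominated by its copies at the indices `i` with `c i ≡ (s , t)`; interchanging
-- the sums then collapses the double sum. Pairs listed twice only enlarge the right side.
∑∑-cover : (c : Fin m → Fin n × Fin n) (F : Fin n → Fin n → ℕ) →
  (∀ s t → F s t ≡ 0 ⊎ ∃ λ i → c i ≡ (s , t)) →
  ∑[ s < n ] ∑[ t < n ] F s t ≤ ∑[ i < m ] F (proj₁ (c i)) (proj₂ (c i))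
∑∑-cover {m} {n} c F covers = begin
  ∑[ s < n ] ∑[ t < n ] F s t              ≤⟨ ∑-mono-≤ (λ s → ∑-mono-≤ (λ t → pointwise s t (covers s t))) ⟩
  ∑[ s < n ] ∑[ t < n ] ∑[ i < m ] K i s t ≡⟨ sum-cong-≗ (λ s → ∑-comm λ t i → K i s t) ⟩
  ∑[ s < n ] ∑[ i < m ] ∑[ t < n ] K i s t ≡⟨ ∑-comm (λ s i → ∑[ t < n ] K i s t) ⟩
  ∑[ i < m ] ∑[ s < n ] ∑[ t < n ] K i s t ≡⟨ sum-cong-≗ (λ i → ∑∑-𝟙 (proj₁ (c i)) (proj₂ (c i)) F) ⟩
  ∑[ i < m ] F (proj₁ (c i)) (proj₂ (c i)) ∎
  where
  open ≤-Reasoning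
  K : Fin m → Fin n → Fin n → ℕ
  K i s t = 𝟙 (proj₁ (c i) ≟ s) * (𝟙 (proj₂ (c i) ≟ t) * F s t)
  pointwise : ∀ s t → F s t ≡ 0 ⊎ (∃ λ i → c i ≡ (s , t)) → F s t ≤ ∑[ i < m ] K i s t
  pointwise s t (inj₁ F≡0) = ≤-trans (≤-reflexive F≡0) z≤n
  pointwise s t (inj₂ (i , cᵢ≡st)) = ≤-trans (≤-reflexive (sym Kᵢ≡F)) (term≤∑ (λ i → K i s t) i)
    where
    Kᵢ≡F : K i s t ≡ F s t
    Kᵢ≡F rewrite cᵢ≡st | 𝟙-yes (s ≟ s) refl | 𝟙-yes (t ≟ t) refl = trans (+-identityʳ _) (+-identityʳ _)

∑∑-pair : (F : Fin n → Fin n → ℕ) {a b c d : Fin n} → (a , b) ≢ (c , d) →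
  F a b + F c d ≤ ∑[ s < n ] ∑[ t < n ] F s t
∑∑-pair {n} F {a} {b} {c} {d} ab≢cd = begin
  F a b + F c d
    ≡⟨ cong₂ _+_ (sym (∑∑-𝟙 a b F)) (sym (∑∑-𝟙 c d F)) ⟩
  ∑[ s < n ] ∑[ t < n ] K a b s t + ∑[ s < n ] ∑[ t < n ] K c d s t
    ≡⟨ sym (∑-distrib-+ (λ s → ∑[ t < n ] K a b s t) (λ s → ∑[ t < n ] K c d s t)) ⟩
  ∑[ s < n ] (∑[ t < n ] K a b s t + ∑[ t < n ] K c d s t)
    ≡⟨ sum-cong-≗ (λ s → sym (∑-distrib-+ (K a b s) (K c d s))) ⟩
  ∑[ s < n ] ∑[ t < n ] (K a b s t + K c d s t)
    ≤⟨ ∑-mono-≤ (λ s → ∑-mono-≤ (pointwise s)) ⟩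
  ∑[ s < n ] ∑[ t < n ] F s t ∎
  where
  open ≤-Reasoning
  K : Fin n → Fin n → Fin n → Fin n → ℕ
  K a b s t = 𝟙 (a ≟ s) * (𝟙 (b ≟ t) * F s t)
  one : ∀ x → x + 0 + 0 ≤ x
  one x = ≤-reflexive (trans (+-identityʳ _) (+-identityʳ _))
  pointwise : ∀ s t → K a b s t + K c d s t ≤ F s t
  pointwise s t with a ≟ s | b ≟ t | c ≟ s | d ≟ t
  ... | yes refl | yes refl | yes refl | yes refl = contradiction refl ab≢cd
  ... | no _     | _        | no _     | _        = z≤n
  ... | no _     | _        | yes _    | no _     = z≤n
  ... | no _     | _        | yes _    | yes _    = one _
  ... | yes _    | no _     | no _     | _        = z≤n
  ... | yes _    | no _     | yes _    | no _     = z≤n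
  ... | yes _    | no _     | yes _    | yes _    = one _
  ... | yes _    | yes _    | no _     | _        = ≤-trans (≤-reflexive (+-identityʳ _)) (one _)
  ... | yes _    | yes _    | yes _    | no _     = ≤-trans (≤-reflexive (+-identityʳ _)) (one _)

∑-comm₄ : (F : Fin m → Fin m → Fin n → Fin n → ℕ) →
  ∑[ s < m ] ∑[ t < m ] ∑[ x < n ] ∑[ y < n ] F s t x y ≡
  ∑[ x < n ] ∑[ y < n ] ∑[ s < m ] ∑[ t < m ] F s t x y
∑-comm₄ {m} {n} F = begin
  ∑[ s < m ] ∑[ t < m ] ∑[ x < n ] ∑[ y < n ] F s t x y
    ≡⟨ sum-cong-≗ (λ s → ∑-comm λ t x → ∑[ y < n ] F s t x y) ⟩
  ∑[ s < m ] ∑[ x < n ] ∑[ t < m ] ∑[ y < n ] F s t x y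
    ≡⟨ ∑-comm (λ s x → ∑[ t < m ] ∑[ y < n ] F s t x y) ⟩
  ∑[ x < n ] ∑[ s < m ] ∑[ t < m ] ∑[ y < n ] F s t x y
    ≡⟨ sum-cong-≗ (λ x → sum-cong-≗ λ s → ∑-comm λ t y → F s t x y) ⟩
  ∑[ x < n ] ∑[ s < m ] ∑[ y < n ] ∑[ t < m ] F s t x y
    ≡⟨ sum-cong-≗ (λ x → ∑-comm λ s y → ∑[ t < m ] F s t x y) ⟩
  ∑[ x < n ] ∑[ y < n ] ∑[ s < m ] ∑[ t < m ] F s t x y ∎
  where open ≡-Reasoning

∑∑-symmetric : (F : Fin n → Fin n → ℕ) → (∀ u v → F u v ≡ F v u) → (∀ u → F u u ≡ 0) →
  2 * ∑[ u < n ] ∑[ v < n ] (𝟙 (u <? v) * F u v) ≡ ∑[ u < n ] ∑[ v < n ] F u v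
∑∑-symmetric {n} F F-sym F-diag = begin
  2 * ∑[ u < n ] ∑[ v < n ] L u v
    ≡⟨ cong (A +_) (+-identityʳ A) ⟩
  ∑[ u < n ] ∑[ v < n ] L u v + ∑[ u < n ] ∑[ v < n ] L u v
    ≡⟨ cong (A +_) (∑-comm L) ⟩
  ∑[ u < n ] ∑[ v < n ] L u v + ∑[ u < n ] ∑[ v < n ] L v u
    ≡⟨ sym (∑-distrib-+ (λ u → ∑[ v < n ] L u v) (λ u → ∑[ v < n ] L v u)) ⟩
  ∑[ u < n ] (∑[ v < n ] L u v + ∑[ v < n ] L v u)
    ≡⟨ sum-cong-≗ (λ u → sym (∑-distrib-+ (L u) (λ v → L v u))) ⟩
  ∑[ u < n ] ∑[ v < n ] (L u v + L v u)
    ≡⟨ sum-cong-≗ (λ u → sum-cong-≗ (split u)) ⟩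
  ∑[ u < n ] ∑[ v < n ] F u v ∎
  where
  open ≡-Reasoning
  L : Fin n → Fin n → ℕ
  L u v = 𝟙 (u <? v) * F u v
  A = ∑[ u < n ] ∑[ v < n ] L u v
  split : ∀ u v → L u v + L v u ≡ F u v
  split u v with Fin.<-cmp u v
  ... | tri< u<v _ v≮u rewrite 𝟙-yes (u <? v) u<v | 𝟙-no (v <? u) v≮u =
    trans (+-identityʳ _) (+-identityʳ _)
  ... | tri> u≮v _ v<u rewrite 𝟙-no (u <? v) u≮v | 𝟙-yes (v <? u) v<u =
    trans (+-identityʳ _) (F-sym v u)
  ... | tri≈ u≮v refl _ rewrite 𝟙-no (u <? u) u≮v = sym (F-diag u)

𝟙-× : ∀ {A B : Set} (a? : Dec A) (b? : Dec B) → 𝟙 (a? ×-dec b?) ≡ 𝟙 a? * 𝟙 b?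
𝟙-× (yes _) (yes _) = refl
𝟙-× (yes _) (no _)  = refl
𝟙-× (no _)  _       = refl

𝟙≤1 : ∀ {A : Set} (a? : Dec A) → 𝟙 a? ≤ 1
𝟙≤1 (yes _) = ≤-refl
𝟙≤1 (no _)  = z≤n

𝟙-mono : ∀ {A B : Set} (a? : Dec A) (b? : Dec B) → (A → B) → 𝟙 a? ≤ 𝟙 b?
𝟙-mono (no _)  b? f = z≤n
𝟙-mono (yes a) b? f = ≤-reflexive (sym (𝟙-yes b? (f a)))

𝟙-≡⇒ : ∀ {A B : Set} (a? : Dec A) (b? : Dec B) → 𝟙 a? ≡ 𝟙 b? → B → A
𝟙-≡⇒ (yes a) b? eq b = a
𝟙-≡⇒ (no _)  b? eq b = case trans eq (𝟙-yes b? b) of λ ()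

-- Walks and distances

module _ {n : ℕ} {R : Rel (Fin n) 0ℓ} where

  walk-++ : ∀ {j k u v w} → Walk R j u v → Walk R k v w → Walk R (j + k) u w
  walk-++ {zero}  refl          q = q
  walk-++ {suc j} (x , r , p) q = x , r , walk-++ p q

  walk-snoc : ∀ {k u v w} → Walk R k u v → R v w → Walk R (suc k) u w
  walk-snoc {zero}  refl        s = _ , s , refl
  walk-snoc {suc k} (x , r , p) s = x , r , walk-snoc p s

  walk-reverse : Symmetric R → ∀ {k u v} → Walk R k u v → Walk R k v u
  walk-reverse R-sym {zero}  refl        = refl
  walk-reverse R-sym {suc k} (x , r , p) = walk-snoc (walk-reverse R-sym p) (R-sym r)

  walk-vertex : ∀ {k u v} → Walk R k u v → Fin (suc k) → Fin n
  walk-vertex {u = u} p           zero    = u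
  walk-vertex {suc k} (_ , _ , p) (suc i) = walk-vertex p i

  walk-take : ∀ {k u v} (p : Walk R k u v) i → Walk R (toℕ i) u (walk-vertex p i)
  walk-take p                   zero    = refl
  walk-take {suc k} (x , r , p) (suc i) = x , r , walk-take p i

  walk-drop : ∀ {k u v} (p : Walk R k u v) i → Walk R (k ∸ toℕ i) (walk-vertex p i) v
  walk-drop p                   zero    = p
  walk-drop {suc k} (_ , _ , p) (suc i) = walk-drop p i

  -- More than `n` positions are visited, so some vertex recurs, and the stretch between its two
  -- visits can be cut out.
  walk-shortcut : ∀ {k u v} → n ≤ k → Walk R k u v → ∃ λ j → j < k × Walk R j u v
  walk-shortcut {k} {u} {v} n≤k p
    with i , j , i<j , pᵢ≡pⱼ ← pigeonhole (s≤s n≤k) (walk-vertex p) =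
    toℕ i + (k ∸ toℕ j) , shorter ,
    walk-++ (walk-take p i) (subst (λ x → Walk R (k ∸ toℕ j) x v) (sym pᵢ≡pⱼ) (walk-drop p j))
    where
    shorter : toℕ i + (k ∸ toℕ j) < k
    shorter = begin-strict
      toℕ i + (k ∸ toℕ j) <⟨ +-monoˡ-< (k ∸ toℕ j) i<j ⟩
      toℕ j + (k ∸ toℕ j) ≡⟨ m+[n∸m]≡n (s≤s⁻¹ (toℕ<n j)) ⟩
      k                   ∎
      where open ≤-Reasoning

  walk-bounded : ∀ {u v} k → Walk R k u v → ∃ λ j → j < n × Walk R j u v
  walk-bounded {u} {v} = <-rec (λ k → Walk R k u v → ∃ λ j → j < n × Walk R j u v) step
    where
    step : ∀ k → (∀ {j} → j < k → Walk R j u v → ∃ λ i → i < n × Walk R i u v) →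
      Walk R k u v → ∃ λ j → j < n × Walk R j u v
    step k rec p with k ℕ.<? n
    ... | yes k<n = k , k<n , p
    ... | no k≮n with j , j<k , q ← walk-shortcut (≮⇒≥ k≮n) p = rec j<k q

least-holds : {P : ℕ → Set} (P? : U.Decidable P) → ∀ {k b} → P k → k < b → P (least P? b)
least-holds P? {k} {suc b} pk k<b with P? zero
... | yes p0 = p0
... | no ¬p0 with k
...   | zero  = contradiction pk ¬p0
...   | suc j = least-holds (λ i → P? (suc i)) pk (s≤s⁻¹ k<b)

least-≤ : {P : ℕ → Set} (P? : U.Decidable P) → ∀ {k} b → P k → least P? b ≤ k
least-≤ P? zero    pk = z≤n
least-≤ P? {k} (suc b) pk with P? zero
... | yes _  = z≤n
... | no ¬p0 with k
...   | zero  = contradiction pk ¬p0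
...   | suc j = s≤s (least-≤ (λ i → P? (suc i)) b pk)

module Metric {n : ℕ} (G : Graph n) (connected : Connected (whole G)) where
  open Graph G

  d : Fin n → Fin n → ℕ
  d = dist G

  -- Connectedness yields a walk shorter than `n`, so the bounded search in `dist` succeeds and its
  -- default value is not returned.
  d-walk : ∀ u v → Walk Adj (d u v) u v
  d-walk u v
    with k , p ← proj₂ connected (∈⊤ {x = u}) (∈⊤ {x = v})
    with j , j<n , q ← walk-bounded k p = least-holds (λ k → walk? adj? k u v) q j<n

  walk⇒d≤ : ∀ {k u v} → Walk Adj k u v → d u v ≤ k
  walk⇒d≤ p = least-≤ (λ k → walk? adj? k _ _) n p

  d-refl : ∀ u → d u u ≡ 0
  d-refl u = n≤0⇒n≡0 (walk⇒d≤ {0} refl)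

  d≡0⇒≡ : ∀ {u v} → d u v ≡ 0 → u ≡ v
  d≡0⇒≡ {u} {v} d≡0 = subst (λ k → Walk Adj k u v) d≡0 (d-walk u v)

  d-sym : ∀ u v → d u v ≡ d v u
  d-sym u v = ≤-antisym (half u v) (half v u)
    where
    half : ∀ u v → d u v ≤ d v u
    half u v = walk⇒d≤ (walk-reverse adj-sym (d-walk v u))

  d-triangle : ∀ u v w → d u w ≤ d u v + d v w
  d-triangle u v w = walk⇒d≤ (walk-++ (d-walk u v) (d-walk v w))

  d-edgeˡ : ∀ {u v} w → Adj u v → d u w ≤ suc (d v w)
  d-edgeˡ {u} {v} w a = walk⇒d≤ (v , a , d-walk v w)

  d-edgeʳ : ∀ {u v} w → Adj u v → d w v ≤ suc (d w u)
  d-edgeʳ {u} {v} w a = walk⇒d≤ (walk-snoc (d-walk w u) a)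

  adj⇒≢ : ∀ {u v} → Adj u v → u ≢ v
  adj⇒≢ a u≡v = adj-irrefl u≡v a

  d-edge : ∀ {u v} → Adj u v → d u v ≡ 1
  d-edge {u} {v} a = ≤-antisym (walk⇒d≤ (v , a , refl)) (n≢0⇒n>0 (adj⇒≢ a ∘ d≡0⇒≡))

  d-step : ∀ {u v k} → d u v ≡ suc k → ∃ λ w → Adj u w × d w v ≡ k
  d-step {u} {v} {k} eq
    with w , a , p ← subst (λ k → Walk Adj k u v) eq (d-walk u v) =
    w , a , ≤-antisym (walk⇒d≤ p) (s≤s⁻¹ (≤-trans (≤-reflexive (sym eq)) (d-edgeˡ v a)))

  -- `at` is total on the natural numbers to avoid dependent indices; only its values up to `d u v`
  -- matter.
  record Geodesic (u v : Fin n) : Set where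
    field
      at       : ℕ → Fin n
      at-adj   : ∀ {i} → i < d u v → Adj (at i) (at (suc i))
      distˡ    : ∀ {i} → i ≤ d u v → d u (at i) ≡ i
      distʳ    : ∀ {i} → i ≤ d u v → d (at i) v ≡ d u v ∸ i

    at-start : at 0 ≡ u
    at-start = sym (d≡0⇒≡ (distˡ z≤n))

    at-end : at (d u v) ≡ v
    at-end = d≡0⇒≡ (trans (distʳ ≤-refl) (n∸n≡0 (d u v)))

  -- The recursion controls distances to `v` only. Those from `u` follow: at most `i` by counting
  -- steps, at least `i` by the triangle inequality.
  geodesic : ∀ u v → Geodesic u v
  geodesic u v = let at , at-0 , adj , dist = go (d u v) u v refl in record
    { at = at ; at-adj = adj ; distʳ = dist
    ; distˡ = λ {i} i≤d → ≤-antisym (near at at-0 adj i≤d) (far at dist i≤d) }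
    where
    go : ∀ k u v → d u v ≡ k → ∃ λ (at : ℕ → Fin n) → at 0 ≡ u ×
      (∀ {i} → i < k → Adj (at i) (at (suc i))) × (∀ {i} → i ≤ k → d (at i) v ≡ k ∸ i)
    go zero    u v eq = (λ _ → u) , refl , (λ ()) , λ { z≤n → eq }
    go (suc k) u v eq
      with w , a , eq′ ← d-step eq
      with at , at-0 , adj , dist ← go k w v eq′ =
      (λ { zero → u ; (suc i) → at i }) , refl ,
      (λ { {zero} _ → subst (Adj u) (sym at-0) a ; {suc i} (s≤s i<k) → adj i<k }) ,
      (λ { {zero} _ → eq ; {suc i} (s≤s i≤k) → dist i≤k })
    near : ∀ at → at 0 ≡ u → (∀ {i} → i < d u v → Adj (at i) (at (suc i))) →
      ∀ {i} → i ≤ d u v → d u (at i) ≤ i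
    near at at-0 adj {zero}  _   = ≤-reflexive (trans (cong (d u) at-0) (d-refl u))
    near at at-0 adj {suc i} i<d = ≤-trans (d-edgeʳ u (adj i<d)) (s≤s (near at at-0 adj (<⇒≤ i<d)))
    far : ∀ at → (∀ {i} → i ≤ d u v → d (at i) v ≡ d u v ∸ i) → ∀ {i} → i ≤ d u v → i ≤ d u (at i)
    far at dist {i} i≤d = +-cancelʳ-≤ (d u v ∸ i) i _ (begin
      i + (d u v ∸ i)           ≡⟨ m+[n∸m]≡n i≤d ⟩
      d u v                     ≤⟨ d-triangle u (at i) v ⟩
      d u (at i) + d (at i) v   ≡⟨ cong (d u (at i) +_) (dist i≤d) ⟩
      d u (at i) + (d u v ∸ i)  ∎)
      where open ≤-Reasoning

-- Connectivity and blocks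

Conn : Rel (Fin n) 0ℓ → Rel (Fin n) 0ℓ
Conn R u v = ∃ λ k → Walk R k u v

module _ {R : Rel (Fin n) 0ℓ} where

  conn-refl : ∀ {u} → Conn R u u
  conn-refl = 0 , refl

  conn-trans : ∀ {u v w} → Conn R u v → Conn R v w → Conn R u w
  conn-trans (j , p) (k , q) = j + k , walk-++ p q

  conn-∷ : ∀ {u v w} → R u v → Conn R v w → Conn R u w
  conn-∷ r (k , p) = suc k , _ , r , p

  conn-sym : Symmetric R → Symmetric (Conn R)
  conn-sym R-sym (k , p) = k , walk-reverse R-sym p

  conn-closed : {P : Fin n → Set} → (∀ {u v} → P u → R u v → P v) →
    ∀ {u v} → Conn R u v → P u → P v
  conn-closed closed (zero  , refl)      pu = pu
  conn-closed closed (suc k , w , r , p) pu = conn-closed closed (k , p) (closed pu r)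

conn-map : {R S : Rel (Fin n) 0ℓ} → (∀ {u v} → R u v → S u v) →
  ∀ {u v} → Conn R u v → Conn S u v
conn-map R⇒S (zero  , refl)      = conn-refl
conn-map R⇒S (suc k , w , r , p) = conn-∷ (R⇒S r) (conn-map R⇒S (k , p))

module _ {P : Fin n → Set} (P? : U.Decidable P) where

  comprehension : Subset n
  comprehension = tabulate λ i → does (P? i)

  ∈-comprehension⁺ : ∀ {i} → P i → i ∈ comprehension
  ∈-comprehension⁺ {i} p = lookup⇒[]= i _ (trans (lookup∘tabulate _ i) (dec-true (P? i) p))

  ∈-comprehension⁻ : ∀ {i} → i ∈ comprehension → P i
  ∈-comprehension⁻ {i} i∈ with P? i in eq
  ... | yes p = p
  ... | no ¬p = case trans (sym ([]=⇒lookup i∈)) (trans (lookup∘tabulate _ i) (cong does eq)) of λ ()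

x∉p-x : ∀ (p : Subset n) x → x ∉ p - x
x∉p-x (_ ∷ p)       zero    ()
x∉p-x (inside  ∷ p) (suc x) (there x∈) = x∉p-x p x x∈
x∉p-x (outside ∷ p) (suc x) (there x∈) = x∉p-x p x x∈

x∈p-y⇒x≢y : ∀ (p : Subset n) {x y} → x ∈ p - y → x ≢ y
x∈p-y⇒x≢y p {x} x∈ refl = x∉p-x p x x∈

⊆∧∣∣≡⇒⊇ : {p q : Subset n} → p ⊆ q → ∣ p ∣ ≡ ∣ q ∣ → q ⊆ p
⊆∧∣∣≡⇒⊇ {p = p} p⊆q eq {x} x∈q with x ∈? p
... | yes x∈p = x∈p
... | no x∉p  = contradiction (p⊂q⇒∣p∣<∣q∣ (p⊆q , x , x∈q , x∉p)) (<-irrefl eq)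

module _ {n : ℕ} {G : Graph n} where
  open Graph G
  open Subgraph

  ⊑-refl : ∀ {H : Subgraph G} → H ⊑ H
  ⊑-refl = id , id

  ⊑-trans : ∀ {H K L : Subgraph G} → H ⊑ K → K ⊑ L → H ⊑ L
  ⊑-trans (V₁ , E₁) (V₂ , E₂) = V₂ ∘ V₁ , E₂ ∘ E₁

  E⇒∈ʳ : ∀ (H : Subgraph G) {u v} → E H u v → v ∈ V H
  E⇒∈ʳ H e = E⇒∈ H (E-sym H e)

  connected-via : ∀ (H : Subgraph G) {r} → r ∈ V H →
    (∀ {v} → v ∈ V H → Conn (E H) v r) → Connected H
  connected-via H r∈ hub = (_ , r∈) ,
    λ u∈ v∈ → conn-trans (hub u∈) (conn-sym (E-sym H) (hub v∈))

  -- If `x` lies outside `B`, no edge of `B` meets it and the connectedness of `B` itself suffices.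
  conn-avoiding : ∀ (B : Subgraph G) → TwoConnected B → ∀ {x u v} →
    u ∈ V B → v ∈ V B → u ≢ x → v ≢ x → Conn (E (B ∖ x)) u v
  conn-avoiding B (_ , (_ , B-conn) , B∖-conn) {x} u∈ v∈ u≢x v≢x with x ∈? V B
  ... | yes x∈ = proj₂ (B∖-conn x∈) (x∈p∧x≢y⇒x∈p-y u∈ u≢x) (x∈p∧x≢y⇒x∈p-y v∈ v≢x)
  ... | no x∉  = conn-map
    (λ e → e , (λ { refl → x∉ (E⇒∈ B e) }) , λ { refl → x∉ (E⇒∈ʳ B e) }) (B-conn u∈ v∈)

  edgeCount : Subgraph G → ℕ
  edgeCount H = ∑[ u < n ] ∑[ v < n ] 𝟙 (E? H u v)

  -- Measure for the growth towards a block: it is bounded, and a larger subgraph of the same size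
  -- adds nothing.
  size : Subgraph G → ℕ
  size H = ∣ V H ∣ + edgeCount H

  size-bound : ℕ
  size-bound = n + ∑[ u < n ] ∑[ v < n ] 1

  size≤bound : ∀ H → size H ≤ size-bound
  size≤bound H = +-mono-≤ (∣p∣≤n (V H)) (∑-mono-≤ λ u → ∑-mono-≤ λ v → 𝟙≤1 (E? H u v))

  module _ {H K : Subgraph G} (H⊑K : H ⊑ K) where

    private
      row-≤ : ∀ u → ∑[ v < n ] 𝟙 (E? H u v) ≤ ∑[ v < n ] 𝟙 (E? K u v)
      row-≤ u = ∑-mono-≤ λ v → 𝟙-mono (E? H u v) (E? K u v) (proj₂ H⊑K)

    size-mono : size H ≤ size K
    size-mono = +-mono-≤ (p⊆q⇒∣p∣≤∣q∣ (proj₁ H⊑K)) (∑-mono-≤ row-≤)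

    size≡⇒⊒ : size H ≡ size K → K ⊑ H
    size≡⇒⊒ eq with V≡ , E≡ ← +-mono-≤-equality (p⊆q⇒∣p∣≤∣q∣ (proj₁ H⊑K)) (∑-mono-≤ row-≤) eq =
      ⊆∧∣∣≡⇒⊇ (proj₁ H⊑K) V≡ ,
      λ {u} {v} → 𝟙-≡⇒ (E? H u v) (E? K u v)
        (∑-mono-≤-equality (λ v → 𝟙-mono (E? H u v) (E? K u v) (proj₂ H⊑K))
          (∑-mono-≤-equality row-≤ E≡ u) v)

  -- The existence of a block is only needed to prove decidable propositions, so its double
  -- negation suffices, and no decision procedure for 2-connectedness is required.
  ¬¬block : ∀ H → TwoConnected H → ¬ ¬ (∃ λ B → IsBlock B × H ⊑ B)
  ¬¬block H = grow (suc size-bound) H (m≤n+m _ _)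
    where
    -- The fuel `k` exceeds the room left below `size-bound`; each strictly larger 2-connected
    -- subgraph costs one unit.
    grow : ∀ k H → size-bound < size H + k → TwoConnected H → ¬ ¬ (∃ λ B → IsBlock B × H ⊑ B)
    grow zero    H big H-tc none =
      <⇒≱ big (≤-trans (≤-reflexive (+-identityʳ _)) (size≤bound H))
    grow (suc k) H big H-tc none = none (H , (H-tc , maximal) , ⊑-refl {H})
      where
      maximal : ∀ K → TwoConnected K → H ⊑ K → K ⊑ H
      maximal K K-tc H⊑K with size H ℕ.≟ size K
      ... | yes eq = size≡⇒⊒ {H} {K} H⊑K eq
      ... | no neq = contradiction
        (λ (B , B-block , K⊑B) → none (B , B-block , ⊑-trans {H} {K} {B} H⊑K K⊑B))
        (grow k K bigger K-tc)
        where
        bigger : size-bound < size K + k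
        bigger = ≤-trans big (≤-trans (≤-reflexive (+-suc (size H) k))
          (+-monoˡ-≤ k (≤∧≢⇒< (size-mono {H} {K} H⊑K) neq)))

  edgeSubgraph : ∀ {p q} → Adj p q → Subgraph G
  edgeSubgraph {p} {q} a = record
    { V     = ⁅ p ⁆ ∪ ⁅ q ⁆
    ; E     = λ u v → (u ≡ p × v ≡ q) ⊎ (u ≡ q × v ≡ p)
    ; E?    = λ u v → (u ≟ p ×-dec v ≟ q) ⊎-dec (u ≟ q ×-dec v ≟ p)
    ; E-sym = λ { (inj₁ (x , y)) → inj₂ (y , x) ; (inj₂ (x , y)) → inj₁ (y , x) }
    ; E⊆Adj = λ { (inj₁ (refl , refl)) → a ; (inj₂ (refl , refl)) → adj-sym a }
    ; E⇒∈   = λ { (inj₁ (refl , _)) → x∈p∪q⁺ (inj₁ (x∈⁅x⁆ p))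
                ; (inj₂ (refl , _)) → x∈p∪q⁺ (inj₂ (x∈⁅x⁆ q)) }
    }

  module _ {p q} (a : Adj p q) where

    private
      H = edgeSubgraph a
      p∈ : p ∈ V H
      p∈ = x∈p∪q⁺ (inj₁ (x∈⁅x⁆ p))
      q∈ : q ∈ V H
      q∈ = x∈p∪q⁺ (inj₂ (x∈⁅x⁆ q))
      p≢q : p ≢ q
      p≢q p≡q = adj-irrefl p≡q a

      ends : ∀ {v} → v ∈ V H → v ≡ p ⊎ v ≡ q
      ends v∈ with x∈p∪q⁻ ⁅ p ⁆ ⁅ q ⁆ v∈
      ... | inj₁ v∈p = inj₁ (x∈⁅y⁆⇒x≡y p v∈p)
      ... | inj₂ v∈q = inj₂ (x∈⁅y⁆⇒x≡y q v∈q)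

      point : ∀ {r x} → r ∈ V (H ∖ x) → (∀ {v} → v ∈ V (H ∖ x) → v ≡ r) → Connected (H ∖ x)
      point {x = x} r∈ only = connected-via (H ∖ x) r∈ λ { v∈ → 0 , only v∈ }

    -- The seed from which a block through a given edge is grown; deleting one end leaves only the
    -- other.
    edgeSubgraph-twoConnected : TwoConnected H
    edgeSubgraph-twoConnected = 2≤∣V∣ , connected-via H p∈ to-p , remove
      where
      2≤∣V∣ : 2 ≤ ∣ V H ∣
      2≤∣V∣ = ≤-<-trans
        (≤-trans (s≤s z≤n) (x∈p⇒∣p-x∣<∣p∣ (x∈p∧x≢y⇒x∈p-y q∈ (p≢q ∘ sym)))) (x∈p⇒∣p-x∣<∣p∣ p∈)
      to-p : ∀ {v} → v ∈ V H → Conn (E H) v p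
      to-p v∈ with ends v∈
      ... | inj₁ refl = conn-refl
      ... | inj₂ refl = conn-∷ (inj₂ (refl , refl)) conn-refl
      remove : ∀ {x} → x ∈ V H → Connected (H ∖ x)
      remove x∈ with ends x∈
      ... | inj₁ refl = point (x∈p∧x≢y⇒x∈p-y q∈ (p≢q ∘ sym)) λ v∈ →
        [ (λ v≡p → contradiction v≡p (x∈p-y⇒x≢y (V H) v∈)) , id ]′ (ends (p─q⊆p _ _ v∈))
      ... | inj₂ refl = point (x∈p∧x≢y⇒x∈p-y p∈ p≢q) λ v∈ →
        [ id , (λ v≡q → contradiction v≡q (x∈p-y⇒x≢y (V H) v∈)) ]′ (ends (p─q⊆p _ _ v∈))

-- Ears

record SimplePath (G : Graph n) (p q : Fin n) : Set where
  open Graph G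
  field
    len       : ℕ
    at        : ℕ → Fin n
    at-start  : at 0 ≡ p
    at-end    : at len ≡ q
    at-adj    : ∀ {i} → i < len → Adj (at i) (at (suc i))
    injective : ∀ {i j} → i ≤ len → j ≤ len → at i ≡ at j → i ≡ j

module _ {n : ℕ} {G : Graph n} (B : Subgraph G) {p q : Fin n} (P : SimplePath G p q) where
  open Graph G
  open Subgraph
  open SimplePath P

  private
    OnPath : Fin n → Set
    OnPath v = ∃ λ (i : Fin (suc len)) → at (toℕ i) ≡ v

    PathEdge : Rel (Fin n) 0ℓ
    PathEdge u v = ∃ λ (i : Fin len) →
      (at (toℕ i) ≡ u × at (suc (toℕ i)) ≡ v) ⊎ (at (toℕ i) ≡ v × at (suc (toℕ i)) ≡ u)

    onPath : ∀ {i} → i ≤ len → OnPath (at i)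
    onPath i≤l = fromℕ< (s≤s i≤l) , cong at (toℕ-fromℕ< (s≤s i≤l))

    pathEdge : ∀ {i} → i < len → PathEdge (at i) (at (suc i))
    pathEdge i<l = fromℕ< i<l , inj₁ (cong at (toℕ-fromℕ< i<l) , cong (at ∘ suc) (toℕ-fromℕ< i<l))

    V? : U.Decidable (λ v → v ∈ V B ⊎ OnPath v)
    V? v = v ∈? V B ⊎-dec any? λ i → at (toℕ i) ≟ v

    pathEdge-sym : Symmetric PathEdge
    pathEdge-sym (i , e) = i , swap e

    pathEdge⇒adj : ∀ {u v} → PathEdge u v → Adj u v
    pathEdge⇒adj (i , inj₁ (refl , refl)) = at-adj (toℕ<n i)
    pathEdge⇒adj (i , inj₂ (refl , refl)) = adj-sym (at-adj (toℕ<n i))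

    pathEdge⇒onPath : ∀ {u v} → PathEdge u v → OnPath u
    pathEdge⇒onPath (i , inj₁ (refl , _)) = onPath (<⇒≤ (toℕ<n i))
    pathEdge⇒onPath (i , inj₂ (_ , refl)) = onPath (toℕ<n i)

  -- With both ends in `B` this attaches an ear; the path may meet `B` in further vertices.
  addPath : Subgraph G
  addPath = record
    { V     = comprehension V?
    ; E     = λ u v → E B u v ⊎ PathEdge u v
    ; E?    = λ u v → E? B u v ⊎-dec any? λ i →
        ((at (toℕ i) ≟ u) ×-dec (at (suc (toℕ i)) ≟ v)) ⊎-dec
        ((at (toℕ i) ≟ v) ×-dec (at (suc (toℕ i)) ≟ u))
    ; E-sym = [ inj₁ ∘ E-sym B , inj₂ ∘ pathEdge-sym ]′
    ; E⊆Adj = [ E⊆Adj B , pathEdge⇒adj ]′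
    ; E⇒∈   = ∈-comprehension⁺ V? ∘ [ inj₁ ∘ E⇒∈ B , inj₂ ∘ pathEdge⇒onPath ]′
    }

  ⊑addPath : B ⊑ addPath
  ⊑addPath = ∈-comprehension⁺ V? ∘ inj₁ , inj₁

  module _ (p≢q : p ≢ q) (p∈B : p ∈ V B) (q∈B : q ∈ V B) (B-tc : TwoConnected B) where

    private
      H = addPath

      B⊆H : V B ⊆ V H
      B⊆H = proj₁ ⊑addPath

      descend : {S : Rel (Fin n) 0ℓ} → ∀ i → (∀ {j} → j < i → S (at (suc j)) (at j)) → Conn S (at i) p
      descend zero    s = 0 , at-start
      descend (suc i) s = conn-∷ (s ≤-refl) (descend i (s ∘ m≤n⇒m≤1+n))

      ascend : {S : Rel (Fin n) 0ℓ} → ∀ k i → i + k ≡ len →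
        (∀ {j} → i ≤ j → j < len → S (at j) (at (suc j))) → Conn S (at i) q
      ascend zero    i eq s = 0 , trans (cong at (trans (sym (+-identityʳ i)) eq)) at-end
      ascend (suc k) i eq s = conn-∷ (s ≤-refl (≤-trans (m≤m+n (suc i) k) (≤-reflexive eq′)))
        (ascend k (suc i) eq′ (s ∘ <⇒≤))
        where
        eq′ : suc i + k ≡ len
        eq′ = trans (sym (+-suc i k)) eq

      -- Deleting x from a simple path leaves at least one of the two ends of the path
      -- reachable from a surviving vertex.
      sides : ∀ x {i} → i ≤ len → at i ≢ x →
        (∀ {j} → j ≤ i → at j ≢ x) ⊎ (∀ {j} → i ≤ j → j ≤ len → at j ≢ x)
      sides x {i} i≤l atᵢ≢x with any? (λ (j : Fin (suc len)) → at (toℕ j) ≟ x)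
      ... | no none = inj₁ λ {j} j≤i atⱼ≡x →
        none (_ , trans (proj₂ (onPath (≤-trans j≤i i≤l))) atⱼ≡x)
      ... | yes (k , atₖ≡x) with ≤-total (toℕ k) i
      ...   | inj₁ k≤i = inj₂ λ {j} i≤j j≤l atⱼ≡x →
        atᵢ≢x (trans (cong at (≤-antisym
          (≤-trans i≤j (≤-reflexive (injective j≤l (s≤s⁻¹ (toℕ<n k)) (trans atⱼ≡x (sym atₖ≡x)))))
          k≤i)) atₖ≡x)
      ...   | inj₂ i≤k = inj₁ λ {j} j≤i atⱼ≡x →
        atᵢ≢x (trans (cong at (≤-antisym i≤k
          (≤-trans (≤-reflexive (sym (injective (≤-trans j≤i i≤l) (s≤s⁻¹ (toℕ<n k))
            (trans atⱼ≡x (sym atₖ≡x))))) j≤i))) atₖ≡x)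

      -- A surviving vertex of the path follows the side that avoids `x` to `p` or `q`; a vertex of
      -- `B` is already in place.
      reach : ∀ {x v} → v ∈ V H → v ≢ x →
        ∃ λ b → b ∈ V B × b ≢ x × Conn (E (H ∖ x)) v b
      reach {x} {v} v∈ v≢x with ∈-comprehension⁻ V? v∈
      ... | inj₁ v∈B = v , v∈B , v≢x , conn-refl
      ... | inj₂ (i , refl) with sides x (s≤s⁻¹ (toℕ<n i)) v≢x
      ...   | inj₁ below = p , p∈B , (λ p≡x → below z≤n (trans at-start p≡x)) ,
        descend (toℕ i) λ j<i →
          inj₂ (pathEdge-sym (pathEdge (≤-trans j<i (s≤s⁻¹ (toℕ<n i))))) , below j<i , below (<⇒≤ j<i)
      ...   | inj₂ above = q , q∈B , (λ q≡x → above (s≤s⁻¹ (toℕ<n i)) ≤-refl (trans at-end q≡x)) ,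
        ascend (len ∸ toℕ i) (toℕ i) (m+[n∸m]≡n (s≤s⁻¹ (toℕ<n i))) λ i≤j j<l →
          inj₂ (pathEdge j<l) , above i≤j (<⇒≤ j<l) , above (m≤n⇒m≤1+n i≤j) j<l

      remaining : ∀ x → ∃ λ r → r ∈ V B × r ≢ x
      remaining x with p ≟ x
      ... | yes refl = q , q∈B , p≢q ∘ sym
      ... | no p≢x   = p , p∈B , p≢x

    -- After the deletion of `x`, every remaining vertex reaches a surviving vertex of `B`, and
    -- these are joined to each other inside `B` avoiding `x`.
    addPath-twoConnected : TwoConnected H
    addPath-twoConnected =
      ≤-trans (proj₁ B-tc) (p⊆q⇒∣p∣≤∣q∣ B⊆H) , connected-via H (B⊆H p∈B) to-p , remove
      where
      to-p : ∀ {v} → v ∈ V H → Conn (E H) v p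
      to-p v∈ with ∈-comprehension⁻ V? v∈
      ... | inj₁ v∈B        = conn-map inj₁ (proj₂ (proj₁ (proj₂ B-tc)) v∈B p∈B)
      ... | inj₂ (i , refl) = descend (toℕ i) λ j<i →
        inj₂ (pathEdge-sym (pathEdge (≤-trans j<i (s≤s⁻¹ (toℕ<n i)))))
      remove : ∀ {x} → x ∈ V H → Connected (H ∖ x)
      remove {x} _ = let r , r∈B , r≢x = remaining x in
        connected-via (H ∖ x) (x∈p∧x≢y⇒x∈p-y (B⊆H r∈B) r≢x) λ v∈ →
          let b , b∈B , b≢x , v~b = reach (p─q⊆p _ _ v∈) (x∈p-y⇒x≢y (V H) v∈)
          in conn-trans v~b (conn-map (λ (e , ≢x) → inj₁ e , ≢x)
               (conn-avoiding B B-tc b∈B r∈B b≢x r≢x))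

    -- By maximality of the block, attaching the path adds no new edge.
    block-absorbs : IsBlock B → ∀ {i} → i < len → E B (at i) (at (suc i))
    block-absorbs B-block i<l =
      proj₂ (proj₂ B-block H addPath-twoConnected ⊑addPath) (inj₂ (pathEdge i<l))

-- Cycles

pigeonhole₃ : ∀ {A : Set} {P Q : A → Set} →
  (∀ {a b} → P a → P b → a ≡ b) → (∀ {a b} → Q a → Q b → a ≡ b) →
  ∀ {a b c} → P a ⊎ Q a → P b ⊎ Q b → P c ⊎ Q c → a ≡ b ⊎ a ≡ c ⊎ b ≡ c
pigeonhole₃ P! Q! (inj₁ a) (inj₁ b) _        = inj₁ (P! a b)
pigeonhole₃ P! Q! (inj₂ a) (inj₂ b) _        = inj₁ (Q! a b)
pigeonhole₃ P! Q! (inj₁ a) (inj₂ b) (inj₁ c) = inj₂ (inj₁ (P! a c))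
pigeonhole₃ P! Q! (inj₁ a) (inj₂ b) (inj₂ c) = inj₂ (inj₂ (Q! b c))
pigeonhole₃ P! Q! (inj₂ a) (inj₁ b) (inj₁ c) = inj₂ (inj₂ (P! b c))
pigeonhole₃ P! Q! (inj₂ a) (inj₁ b) (inj₂ c) = inj₂ (inj₁ (Q! a c))

Next-functional : ∀ {k} {i j j′ : Fin k} → Next i j → Next i j′ → j ≡ j′
Next-functional (inj₁ e) (inj₁ e′) = toℕ-injective (trans (sym e) e′)
Next-functional {j = j} (inj₁ e) (inj₂ (e′ , _)) = contradiction (trans (sym e) e′) (<⇒≢ (toℕ<n j))
Next-functional {j′ = j′} (inj₂ (e , _)) (inj₁ e′) = contradiction (trans (sym e′) e) (<⇒≢ (toℕ<n j′))
Next-functional (inj₂ (_ , e)) (inj₂ (_ , e′)) = toℕ-injective (trans e (sym e′))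

Next-injective : ∀ {k} {i i′ j : Fin k} → Next i j → Next i′ j → i ≡ i′
Next-injective (inj₁ e) (inj₁ e′) = toℕ-injective (suc-injective (trans e (sym e′)))
Next-injective (inj₁ e) (inj₂ (_ , e′)) = case trans e e′ of λ ()
Next-injective (inj₂ (_ , e)) (inj₁ e′) = case trans e′ e of λ ()
Next-injective (inj₂ (e , _)) (inj₂ (e′ , _)) = toℕ-injective (suc-injective (trans e (sym e′)))

module _ {n : ℕ} {G : Graph n} where
  open Graph G
  open Subgraph

  -- The property common to edges and cycles through which the cactus condition enters the
  -- inequality.
  DegreeAtMostTwo : Subgraph G → Set
  DegreeAtMostTwo H = ∀ {u a b c} → E H u a → E H u b → E H u c → a ≡ b ⊎ a ≡ c ⊎ b ≡ c

  edge-degree : ∀ (H : Subgraph G) → IsEdge H → DegreeAtMostTwo H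
  edge-degree H (x , y , _ , ends) ua ub uc =
    pigeonhole₃ (λ p q → trans p (sym q)) (λ p q → trans p (sym q))
      (ends (E⇒∈ʳ H ua)) (ends (E⇒∈ʳ H ub)) (ends (E⇒∈ʳ H uc))

  cycle-degree : ∀ (H : Subgraph G) {k} → IsCycle H k → DegreeAtMostTwo H
  cycle-degree H {k} C {u} ua ub uc =
    pigeonhole₃ (same Next-functional) (same Next-injective) (side ua) (side ub) (side uc)
    where
    open IsCycle C
    Via : Rel (Fin k) 0ℓ → Fin n → Set
    Via R v = ∃₂ λ i j → R i j × vertex i ≡ u × vertex j ≡ v
    side : ∀ {v} → E H u v → Via Next v ⊎ Via (λ i j → Next j i) v
    side e with Equivalence.to edges e
    ... | i , j , inj₁ ij , i≡u , j≡v = inj₁ (i , j , ij , i≡u , j≡v)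
    ... | i , j , inj₂ ji , i≡u , j≡v = inj₂ (i , j , ji , i≡u , j≡v)
    same : ∀ {R : Rel (Fin k) 0ℓ} → (∀ {i j j′} → R i j → R i j′ → j ≡ j′) →
      ∀ {v w} → Via R v → Via R w → v ≡ w
    same R! (i , j , r , i≡u , refl) (i′ , j′ , r′ , i′≡u , refl)
      with refl ← IsCycle.injective C (trans i≡u (sym i′≡u)) = cong vertex (R! r r′)

module _ {n : ℕ} {G : Graph n} (B : Subgraph G) (B-block : IsBlock B) (B-degree : DegreeAtMostTwo B)
  {p q : Fin n} (pq∈B : Subgraph.E B p q) (P : SimplePath G p q) (2≤len : 2 ≤ SimplePath.len P) where
  open Graph G
  open Subgraph
  open SimplePath P

  private
    step∈B : ∀ {i} → i < len → E B (at i) (at (suc i))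
    step∈B = block-absorbs B P (λ p≡q → adj-irrefl p≡q (E⊆Adj B pq∈B))
      (E⇒∈ B pq∈B) (E⇒∈ʳ B pq∈B) (proj₁ B-block) B-block

  -- The path lies in `B`, so `at j` already has two neighbours there: along the path, or via `pq`
  -- at an end. They are distinct because `2 ≤ len`, and the degree bound leaves no third one.
  pathNeighbour : ∀ {j v} → j ≤ len → E B (at j) v →
    (j < len × at (suc j) ≡ v) ⊎ (∃ λ i → j ≡ suc i × at i ≡ v) ⊎ (j ≡ 0 × v ≡ q) ⊎ (j ≡ len × v ≡ p)
  pathNeighbour {zero} {v} _ e
    with B-degree (step∈B (≤-trans (s≤s z≤n) 2≤len)) (subst (λ x → E B x q) (sym at-start) pq∈B) e
  ... | inj₁ at₁≡q        = contradiction
    (injective (<⇒≤ 2≤len) ≤-refl (trans at₁≡q (sym at-end))) (<⇒≢ 2≤len)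
  ... | inj₂ (inj₁ at₁≡v) = inj₁ (≤-trans (s≤s z≤n) 2≤len , at₁≡v)
  ... | inj₂ (inj₂ q≡v)   = inj₂ (inj₂ (inj₁ (refl , sym q≡v)))
  pathNeighbour {suc i} {v} j≤l e with m≤n⇒m<n∨m≡n j≤l
  ... | inj₁ j<l with B-degree (E-sym B (step∈B j≤l)) (step∈B j<l) e
  ...   | inj₁ atᵢ≡atᵢ₊₂ = contradiction (injective (<⇒≤ j≤l) j<l atᵢ≡atᵢ₊₂) (<⇒≢ (s≤s (n≤1+n i)))
  ...   | inj₂ (inj₁ atᵢ≡v)   = inj₂ (inj₁ (i , refl , atᵢ≡v))
  ...   | inj₂ (inj₂ atᵢ₊₂≡v) = inj₁ (j<l , atᵢ₊₂≡v)
  pathNeighbour {suc i} {v} j≤l e | inj₂ refl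
    with B-degree (E-sym B (step∈B j≤l)) (subst (λ x → E B x p) (sym at-end) (E-sym B pq∈B)) e
  ...   | inj₁ atᵢ≡p        = contradiction
    (injective (n≤1+n i) z≤n (trans atᵢ≡p (sym at-start))) (>⇒≢ (s≤s⁻¹ 2≤len))
  ...   | inj₂ (inj₁ atᵢ≡v) = inj₂ (inj₁ (i , refl , atᵢ≡v))
  ...   | inj₂ (inj₂ p≡v)   = inj₂ (inj₂ (inj₂ (refl , sym p≡v)))

  pathVertex-closed : ∀ {u v} → (∃ λ i → i ≤ len × at i ≡ u) → E B u v → ∃ λ i → i ≤ len × at i ≡ v
  pathVertex-closed (j , j≤l , refl) e with pathNeighbour j≤l e
  ... | inj₁ (j<l , eq)                    = suc j , j<l , eq
  ... | inj₂ (inj₁ (i , refl , eq))        = i , <⇒≤ j≤l , eq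
  ... | inj₂ (inj₂ (inj₁ (_ , refl)))      = len , ≤-refl , at-end
  ... | inj₂ (inj₂ (inj₂ (_ , refl)))      = 0 , z≤n , at-start

  -- `B` is connected and no edge of `B` leaves the path, so the path together with `pq` is all of
  -- `B`.
  pathVertex : ∀ {v} → v ∈ V B → ∃ λ i → i ≤ len × at i ≡ v
  pathVertex v∈ = conn-closed pathVertex-closed
    (proj₂ (proj₁ (proj₂ (proj₁ B-block))) (E⇒∈ B pq∈B) v∈) (0 , z≤n , at-start)

  at∈B : ∀ {i} → i ≤ len → at i ∈ V B
  at∈B {zero}  _   = subst (_∈ V B) (sym at-start) (E⇒∈ B pq∈B)
  at∈B {suc i} i<l = E⇒∈ʳ B (step∈B i<l)

  -- The corners of the cycle and the `suc len` positions of the path enumerate the same vertices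
  -- without repetition, which gives injections both ways.
  cycle-length : ∀ {k} → IsCycle B k → k ≡ suc len
  cycle-length {k} C = ≤-antisym (injective⇒≤ index-injective) (injective⇒≤ corner-injective)
    where
    open IsCycle C using (vertex; vertices)
    vertexIndex : ∀ i → ∃ λ j → j ≤ len × at j ≡ vertex i
    vertexIndex i = pathVertex (Equivalence.from vertices (i , refl))
    index : Fin k → Fin (suc len)
    index i = fromℕ< (s≤s (proj₁ (proj₂ (vertexIndex i))))
    at-index : ∀ i → at (toℕ (index i)) ≡ vertex i
    at-index i = trans (cong at (toℕ-fromℕ< (s≤s (proj₁ (proj₂ (vertexIndex i))))))
                       (proj₂ (proj₂ (vertexIndex i)))
    index-injective : ∀ {i j} → index i ≡ index j → i ≡ j
    index-injective {i} {j} eq = IsCycle.injective C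
      (trans (sym (at-index i)) (trans (cong (at ∘ toℕ) eq) (at-index j)))
    vertexAt : ∀ (j : Fin (suc len)) → ∃ λ i → vertex i ≡ at (toℕ j)
    vertexAt j = Equivalence.to vertices (at∈B (s≤s⁻¹ (toℕ<n j)))
    corner : Fin (suc len) → Fin k
    corner j = proj₁ (vertexAt j)
    corner-injective : ∀ {i j} → corner i ≡ corner j → i ≡ j
    corner-injective {i} {j} eq = toℕ-injective (injective (s≤s⁻¹ (toℕ<n i)) (s≤s⁻¹ (toℕ<n j))
      (trans (sym (proj₂ (vertexAt i))) (trans (cong vertex eq) (proj₂ (vertexAt j)))))

-- Edges separating two vertices

-- Antitonicity makes every truncated difference exact.
telescope : ∀ (h : ℕ → ℕ) l → (∀ {i} → i < l → h (suc i) ≤ h i) →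
  ∑[ i < l ] (h (toℕ i) ∸ h (suc (toℕ i))) + h l ≡ h 0
telescope h zero    anti = refl
telescope h (suc l) anti = begin
  (h 0 ∸ h 1) + rest + h (suc l)   ≡⟨ +-assoc (h 0 ∸ h 1) rest _ ⟩
  (h 0 ∸ h 1) + (rest + h (suc l)) ≡⟨ cong (h 0 ∸ h 1 +_) (telescope (h ∘ suc) l (λ i<l → anti (s≤s i<l))) ⟩
  (h 0 ∸ h 1) + h 1                ≡⟨ m∸n+n≡m (anti (s≤s z≤n)) ⟩
  h 0                              ∎
  where
  open ≡-Reasoning
  rest = ∑[ i < l ] (h (suc (toℕ i)) ∸ h (suc (suc (toℕ i))))

-- The difference is at most 1 and has the parity of the sum, which is even.
near-even⇒≡ : ∀ a b → a ≤ suc b → b ≤ suc a → 2 ∣ suc (suc (a + b)) → a ≡ b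
near-even⇒≡ zero    zero          _ _ _   = refl
near-even⇒≡ zero    (suc zero)    _ _ 2∣3 = contradiction (∣m+n∣m⇒∣n {2} {2} {1} 2∣3 ∣-refl) (>⇒∤ ≤-refl)
near-even⇒≡ zero    (suc (suc b)) _ (s≤s ()) _
near-even⇒≡ (suc zero)    zero _ _ 2∣3 = contradiction (∣m+n∣m⇒∣n {2} {2} {1} 2∣3 ∣-refl) (>⇒∤ ≤-refl)
near-even⇒≡ (suc (suc a)) zero (s≤s ()) _ _
near-even⇒≡ (suc a) (suc b) (s≤s p) (s≤s q) even = cong suc (near-even⇒≡ a b p q
  (∣m+n∣m⇒∣n {2} {2} (subst (λ x → 2 ∣ suc (suc (suc x))) (+-suc a b) even) ∣-refl))

module _ {n : ℕ} (G : Graph n) (connected : Connected (whole G)) where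
  open Graph G
  open Subgraph
  open Metric G connected

  -- The positive part of (d y s - d x s) - (d y t - d x t).
  Δ : Fin n → Fin n → Fin n → Fin n → ℕ
  Δ x y s t = (d y s + d x t) ∸ (d x s + d y t)

  -- Orientation matters: `s` is the end nearer to `x`, so each undirected edge counts at most once
  -- in `sep x y`.
  Separates : Fin n → Fin n → Fin n → Fin n → Set
  Separates x y s t = Adj s t × d x s < d x t × d y t < d y s

  separates? : ∀ x y s t → Dec (Separates x y s t)
  separates? x y s t = adj? s t ×-dec (d x s ℕ.<? d x t) ×-dec (d y t ℕ.<? d y s)

  sep : Fin n → Fin n → ℕ
  sep x y = ∑[ s < n ] ∑[ t < n ] 𝟙 (separates? x y s t)

  Separates⇒2≤Δ : ∀ {x y s t} → Separates x y s t → 2 ≤ Δ x y s t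
  Separates⇒2≤Δ {x} {y} {s} {t} (_ , xs<xt , yt<ys) = m+n≤o⇒m≤o∸n 2 (begin
    2 + (d x s + d y t)       ≡⟨ cong suc (sym (+-suc (d x s) (d y t))) ⟩
    suc (d x s) + suc (d y t) ≤⟨ +-mono-≤ xs<xt yt<ys ⟩
    d x t + d y s             ≡⟨ +-comm (d x t) (d y s) ⟩
    d y s + d x t             ∎)
    where open ≤-Reasoning

  -- This exchanges the roles of pair and edge, so that an edge on a geodesic can be viewed as a
  -- drop relative to `st`.
  Δ-symmetric : ∀ x y s t → Δ x y s t ≡ Δ s t x y
  Δ-symmetric x y s t
    rewrite d-sym y s | d-sym x t | d-sym x s | d-sym y t =
    cong (_∸ (d s x + d t y)) (+-comm (d s y) (d t x))

  -- The signed differences add up over `z`, and taking positive parts is subadditive. Adding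
  -- `zs + zt` to both sides avoids negative numbers.
  Δ-triangle : ∀ x z y s t → Δ x y s t ≤ Δ x z s t + Δ z y s t
  Δ-triangle x z y s t = lemma (d y s) (d x t) (d x s) (d y t) (d z s) (d z t)
    where
    lemma : ∀ ys xt xs yt zs zt →
      (ys + xt) ∸ (xs + yt) ≤ ((zs + xt) ∸ (xs + zt)) + ((ys + zt) ∸ (zs + yt))
    lemma ys xt xs yt zs zt = m≤n+o⇒m∸n≤o (ys + xt) (xs + yt) (+-cancelʳ-≤ (zs + zt) _ _ (begin
      ys + xt + (zs + zt)             ≡⟨ r₁ ys xt zs zt ⟩
      (zs + xt) + (ys + zt)           ≤⟨ +-mono-≤ (m≤n+m∸n (zs + xt) (xs + zt)) (m≤n+m∸n (ys + zt) (zs + yt)) ⟩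
      (xs + zt + A) + (zs + yt + C)   ≡⟨ r₂ xs zt A zs yt C ⟩
      xs + yt + (A + C) + (zs + zt)   ∎))
      where
      open ≤-Reasoning
      A = (zs + xt) ∸ (xs + zt)
      C = (ys + zt) ∸ (zs + yt)
      r₁ : ∀ ys xt zs zt → ys + xt + (zs + zt) ≡ (zs + xt) + (ys + zt)
      r₁ = solve-∀
      r₂ : ∀ xs zt A zs yt C → (xs + zt + A) + (zs + yt + C) ≡ xs + yt + (A + C) + (zs + zt)
      r₂ = solve-∀

  -- Position relative to an edge, and the cycle through a drop

  module Edge {p q : Fin n} (pq : Adj p q) where

    p≢q : p ≢ q
    p≢q = adj⇒≢ pq

    -- The position of v relative to pq: 2, 1 or 0 according to whether v is closer to p,
    -- equidistant, or closer to q.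
    H : Fin n → ℕ
    H v = suc (d q v) ∸ d p v

    H+d : ∀ v → H v + d p v ≡ suc (d q v)
    H+d v = m∸n+n≡m (d-edgeˡ v pq)

    H-start : H p ≡ 2
    H-start rewrite d-refl p | d-edge (adj-sym pq) = refl

    H-end : H q ≡ 0
    H-end rewrite d-refl q | d-edge pq = refl

    H≤2 : ∀ v → H v ≤ 2
    H≤2 v = +-cancelʳ-≤ (d p v) _ _
      (≤-trans (≤-reflexive (H+d v)) (s≤s (d-edgeˡ v (adj-sym pq))))

    -- `H` is a potential: the variation of the pair `p`, `q` along `st` is its descent from `s` to
    -- `t`.
    Δ≡H∸H : ∀ s t → Δ p q s t ≡ H s ∸ H t
    Δ≡H∸H s t = begin
      (d q s + d p t) ∸ (d p s + d q t)
        ≡⟨⟩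
      (suc (d q s) + d p t) ∸ suc (d p s + d q t)
        ≡⟨ cong ((suc (d q s) + d p t) ∸_) (sym (+-suc (d p s) (d q t))) ⟩
      (suc (d q s) + d p t) ∸ (d p s + suc (d q t))
        ≡⟨ sym (cong₂ (λ x y → (x + d p t) ∸ (d p s + y)) (H+d s) (H+d t)) ⟩
      (H s + d p s + d p t) ∸ (d p s + (H t + d p t))
        ≡⟨ cong₂ _∸_ (r₁ (H s) (d p s) (d p t)) (r₂ (H t) (d p s) (d p t)) ⟩
      (d p s + d p t + H s) ∸ (d p s + d p t + H t)
        ≡⟨ [m+n]∸[m+o]≡n∸o (d p s + d p t) (H s) (H t) ⟩
      H s ∸ H t ∎
      where
      open ≡-Reasoning
      r₁ : ∀ h a b → h + a + b ≡ a + b + h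
      r₁ = solve-∀
      r₂ : ∀ h a b → a + (h + b) ≡ a + b + h
      r₂ = solve-∀

    -- The edge `pq`, along which `H` falls from 2 to 0, is excluded and accounted for separately,
    -- because a drop is to be closed up with it to a cycle.
    Drop : Fin n → Fin n → Set
    Drop s t = Adj s t × H t < H s × (s , t) ≢ (p , q)

    drop? : ∀ s t → Dec (Drop s t)
    drop? s t = adj? s t ×-dec (H t ℕ.<? H s) ×-dec ¬? (≡-dec _≟_ _≟_ (s , t) (p , q))

    0<Δ⇒drop : ∀ {s t} → Adj s t → 0 < Δ p q s t → (s , t) ≢ (p , q) → Drop s t
    0<Δ⇒drop {s} {t} st Δ>0 ≢pq =
      st , m∸n≢0⇒n<m (>⇒≢ (subst (0 <_) (Δ≡H∸H s t) Δ>0)) , ≢pq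

    module DropPath {s t : Fin n} (drop : Drop s t) where

      private
        st = proj₁ drop
        Ht<Hs = proj₁ (proj₂ drop)
        module S = Geodesic (geodesic p s)
        module T = Geodesic (geodesic t q)

      a b len : ℕ
      a = d p s
      b = d t q
      len = suc (a + b)

      -- `H s` is positive, so `s` is no farther from `p` than from `q`; crossing `st` costs at most
      -- one more. Dually, `H t` is at most 1, which bounds `b`.
      a≤1+b : a ≤ suc b
      a≤1+b = begin
        d p s       ≤⟨ s≤s⁻¹ (≤-trans (+-monoˡ-≤ (d p s) (≤-trans (s≤s z≤n) Ht<Hs)) (≤-reflexive (H+d s))) ⟩
        d q s       ≤⟨ d-edgeʳ q (adj-sym st) ⟩
        suc (d q t) ≡⟨ cong suc (d-sym q t) ⟩
        suc b       ∎
        where open ≤-Reasoning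

      b≤1+a : b ≤ suc a
      b≤1+a = begin
        d t q       ≡⟨ d-sym t q ⟩
        d q t       ≤⟨ s≤s⁻¹ (≤-trans (≤-reflexive (sym (H+d t)))
                         (+-monoˡ-≤ (d p t) (s≤s⁻¹ (≤-trans Ht<Hs (H≤2 s))))) ⟩
        d p t       ≤⟨ d-edgeʳ p st ⟩
        suc (d p s) ∎
        where open ≤-Reasoning

      -- A geodesic from `p` to `s`, the edge `st`, and a geodesic from `t` to `q`. Index `a` is
      -- `s`, index `suc a` is `t`.
      at : ℕ → Fin n
      at i with i ≤? a
      ... | yes _ = S.at i
      ... | no _  = T.at (i ∸ suc a)

      at-low : ∀ {i} → i ≤ a → at i ≡ S.at i
      at-low {i} i≤a with i ≤? a
      ... | yes _  = refl
      ... | no i≰a = contradiction i≤a i≰a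

      at-high : ∀ j → at (suc (a + j)) ≡ T.at j
      at-high j with suc (a + j) ≤? a
      ... | yes p = contradiction p (m+n≮m a j)
      ... | no _  = cong T.at (m+n∸m≡n a j)

      data Part : ℕ → Set where
        low  : ∀ {i} → i ≤ a → Part i
        high : ∀ j → j ≤ b → Part (suc (a + j))

      part : ∀ {i} → i ≤ len → Part i
      part {i} i≤l with i ≤? a
      ... | yes i≤a = low i≤a
      ... | no i≰a with j , refl ← m≤n⇒∃[o]m+o≡n (≰⇒> i≰a) =
        high j (+-cancelˡ-≤ (suc a) _ _ i≤l)

      dist-low : ∀ {i} → i ≤ a → d p (at i) ≡ i
      dist-low i≤a = trans (cong (d p) (at-low i≤a)) (S.distˡ i≤a)

      dist-high : ∀ {j} → j ≤ b → d (at (suc (a + j))) q ≡ b ∸ j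
      dist-high {j} j≤b = trans (cong (λ x → d x q) (at-high j)) (T.distʳ j≤b)

      at-a : at a ≡ s
      at-a = trans (at-low ≤-refl) S.at-end

      at-1+a : at (suc a) ≡ t
      at-1+a = trans (cong (at ∘ suc) (sym (+-identityʳ a))) (trans (at-high 0) T.at-start)

      at-end : at len ≡ q
      at-end = trans (at-high b) T.at-end

      at-suc-high : ∀ j → at (suc (suc (a + j))) ≡ T.at (suc j)
      at-suc-high j = trans (cong (at ∘ suc) (sym (+-suc a j))) (at-high (suc j))

      at-adj : ∀ {i} → i < len → Adj (at i) (at (suc i))
      at-adj i<l with part (<⇒≤ i<l)
      ... | low i≤a with m≤n⇒m<n∨m≡n i≤a
      ...   | inj₁ i<a  = subst₂ Adj (sym (at-low i≤a)) (sym (at-low i<a)) (S.at-adj i<a)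
      ...   | inj₂ refl = subst₂ Adj (sym at-a) (sym at-1+a) st
      at-adj i<l | high j _ = subst₂ Adj (sym (at-high j)) (sym (at-suc-high j))
        (T.at-adj (+-cancelˡ-< (suc a) j b i<l))

      -- Up to `s`, the distance to `p` grows by one per step and that to `q` by at most one. From
      -- `t` on, the distance to `q` falls by one and that to `p` by at most one. Across `st` it is
      -- the hypothesis.
      H-step : ∀ {i} → i < len → H (at (suc i)) ≤ H (at i)
      H-step {i} i<l with part (<⇒≤ i<l)
      ... | low i≤a with m≤n⇒m<n∨m≡n i≤a
      ...   | inj₂ refl = subst₂ (λ x y → H x ≤ H y) (sym at-1+a) (sym at-a) (<⇒≤ Ht<Hs)
      ...   | inj₁ i<a  = +-cancelʳ-≤ (suc i) _ _ (begin
        H x′ + suc i     ≡⟨ cong (H x′ +_) (sym (dist-low i<a)) ⟩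
        H x′ + d p x′    ≡⟨ H+d x′ ⟩
        suc (d q x′)     ≤⟨ s≤s (d-edgeʳ q (at-adj i<l)) ⟩
        suc (suc (d q x)) ≡⟨ cong suc (sym (H+d x)) ⟩
        suc (H x + d p x) ≡⟨ cong (λ k → suc (H x + k)) (dist-low i≤a) ⟩
        suc (H x + i)    ≡⟨ sym (+-suc (H x) i) ⟩
        H x + suc i      ∎)
        where
        open ≤-Reasoning
        x = at i
        x′ = at (suc i)
      H-step {i} i<l | high j j≤b = +-cancelʳ-≤ (d p x) _ _ (begin
        H x′ + d p x         ≤⟨ +-monoʳ-≤ (H x′) (d-edgeˡ′ (at-adj i<l)) ⟩
        H x′ + suc (d p x′)  ≡⟨ +-suc (H x′) (d p x′) ⟩
        suc (H x′ + d p x′)  ≡⟨ cong suc (H+d x′) ⟩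
        suc (suc (d q x′))   ≡⟨ cong suc (sym closer-to-q) ⟩
        suc (d q x)          ≡⟨ sym (H+d x) ⟩
        H x + d p x          ∎)
        where
        open ≤-Reasoning
        x = at i
        x′ = at (suc i)
        j<b : j < b
        j<b = +-cancelˡ-< (suc a) j b i<l
        d-edgeˡ′ : ∀ {u v} → Adj u v → d p u ≤ suc (d p v)
        d-edgeˡ′ uv = d-edgeʳ p (adj-sym uv)
        closer-to-q : d q x ≡ suc (d q x′)
        closer-to-q = begin-equality
          d q x                ≡⟨ d-sym q x ⟩
          d x q                ≡⟨ dist-high j≤b ⟩
          b ∸ j                ≡⟨ +-∸-assoc 1 j<b ⟩
          suc (b ∸ suc j)      ≡⟨ cong suc (sym (trans (cong (λ y → d y q) (at-suc-high j)) (T.distʳ j<b))) ⟩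
          suc (d x′ q)         ≡⟨ cong suc (d-sym x′ q) ⟩
          suc (d q x′)         ∎

      H-antitone : ∀ {i} j → i ≤ j → j ≤ len → H (at j) ≤ H (at i)
      H-antitone {i} j i≤j j≤l with m≤n⇒m<n∨m≡n i≤j
      ... | inj₂ refl = ≤-refl
      H-antitone {i} (suc j) i≤j j<l | inj₁ i<j =
        ≤-trans (H-step j<l) (H-antitone j (s≤s⁻¹ i<j) (<⇒≤ j<l))

      -- Before the edge `st` the value of `H` is at least `H s`, after it at most `H t`, so the two
      -- geodesics are disjoint.
      low≢high : ∀ {i j} → i ≤ a → j ≤ b → at i ≢ at (suc (a + j))
      low≢high {i} {j} i≤a j≤b eq = <-irrefl (cong H (sym eq)) (begin-strict
        H (at (suc (a + j))) ≤⟨ H-antitone (suc (a + j)) (s≤s (m≤m+n a j)) (s≤s (+-monoʳ-≤ a j≤b)) ⟩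
        H (at (suc a))       ≡⟨ cong H at-1+a ⟩
        H t                  <⟨ Ht<Hs ⟩
        H s                  ≡⟨ cong H (sym at-a) ⟩
        H (at a)             ≤⟨ H-antitone a i≤a (m≤n⇒m≤1+n (m≤m+n a b)) ⟩
        H (at i)             ∎)
        where open ≤-Reasoning

      injective : ∀ {i j} → i ≤ len → j ≤ len → at i ≡ at j → i ≡ j
      injective i≤l j≤l eq with part i≤l | part j≤l
      ... | low i≤a    | low j≤a    = trans (sym (dist-low i≤a)) (trans (cong (d p) eq) (dist-low j≤a))
      ... | low i≤a    | high j j≤b = contradiction eq (low≢high i≤a j≤b)
      ... | high i i≤b | low j≤a    = contradiction (sym eq) (low≢high j≤a i≤b)
      ... | high i i≤b | high j j≤b = cong (λ k → suc (a + k)) (∸-cancelˡ-≡ i≤b j≤b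
        (trans (sym (dist-high i≤b)) (trans (cong (λ x → d x q) eq) (dist-high j≤b))))

      at-start : at 0 ≡ p
      at-start = trans (at-low z≤n) S.at-start

      path : SimplePath G p q
      path = record
        { len = len ; at = at ; at-start = at-start ; at-end = at-end
        ; at-adj = at-adj ; injective = injective }

      -- Length 1 would mean `s ≡ p` and `t ≡ q`, which a drop excludes.
      2≤len : 2 ≤ len
      2≤len = s≤s (n≢0⇒n>0 λ a+b≡0 → proj₂ (proj₂ drop)
        (cong₂ _,_ (sym (d≡0⇒≡ (m+n≡0⇒m≡0 a a+b≡0))) (d≡0⇒≡ (m+n≡0⇒n≡0 a a+b≡0))))

      total-drop : ∑[ i < len ] (H (at (toℕ i)) ∸ H (at (suc (toℕ i)))) ≡ 2
      total-drop = begin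
        ∑[ i < len ] (H (at (toℕ i)) ∸ H (at (suc (toℕ i))))
          ≡⟨ sym (+-identityʳ _) ⟩
        ∑[ i < len ] (H (at (toℕ i)) ∸ H (at (suc (toℕ i)))) + 0
          ≡⟨ cong (∑[ i < len ] (H (at (toℕ i)) ∸ H (at (suc (toℕ i)))) +_) (sym (trans (cong H at-end) H-end)) ⟩
        ∑[ i < len ] (H (at (toℕ i)) ∸ H (at (suc (toℕ i)))) + H (at len)
          ≡⟨ telescope (H ∘ at) len H-step ⟩
        H (at 0)
          ≡⟨ trans (cong H at-start) H-start ⟩
        2 ∎
        where open ≡-Reasoning

  -- Drops inside a block of degree at most two

  module InBlock {p q : Fin n} (pq : Adj p q) (B : Subgraph G) (B-block : IsBlock B)
    (B-degree : DegreeAtMostTwo B) (pq∈B : E B p q) where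
    open Edge pq

    drop∈B : ∀ {s t} → Drop s t → E B s t
    drop∈B D = subst₂ (E B) at-a at-1+a
      (block-absorbs B path p≢q (E⇒∈ B pq∈B) (E⇒∈ʳ B pq∈B) (proj₁ B-block) B-block (s≤s (m≤m+n a b)))
      where open DropPath D

    -- The path of `D` and `pq` make up all of `B`, so the second drop is one of these edges.
    -- Against the path `H` does not fall, `(p , q)` is excluded, and nothing falls into `p`, where
    -- `H` is maximal.
    drop-on-path : ∀ {s t s′ t′} (D : Drop s t) → Drop s′ t′ →
      let open DropPath D in ∃ λ i → i < len × at i ≡ s′ × at (suc i) ≡ t′
    drop-on-path {s′ = s′} {t′} D D′@(_ , Ht′<Hs′ , ≢pq) =
      locate (pathVertex B B-block B-degree pq∈B path 2≤len (E⇒∈ B (drop∈B D′)))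
      where
      open DropPath D
      forward : ∀ {i} → i ≤ len → at i ≡ s′ →
        (i < len × at (suc i) ≡ t′) ⊎ (∃ λ j → i ≡ suc j × at j ≡ t′) ⊎
          (i ≡ 0 × t′ ≡ q) ⊎ (i ≡ len × t′ ≡ p) →
        ∃ λ i → i < len × at i ≡ s′ × at (suc i) ≡ t′
      forward {i} _ atᵢ≡s′ (inj₁ (i<l , eq)) = i , i<l , atᵢ≡s′ , eq
      forward i≤l atᵢ≡s′ (inj₂ (inj₁ (j , refl , eq))) =
        contradiction Ht′<Hs′ (≤⇒≯ (subst₂ (λ x y → H x ≤ H y) atᵢ≡s′ eq (H-step i≤l)))
      forward _ atᵢ≡s′ (inj₂ (inj₂ (inj₁ (refl , t′≡q)))) =
        contradiction (cong₂ _,_ (trans (sym atᵢ≡s′) at-start) t′≡q) ≢pq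
      forward _ _ (inj₂ (inj₂ (inj₂ (_ , t′≡p)))) = contradiction Ht′<Hs′
        (≤⇒≯ (≤-trans (H≤2 s′) (≤-reflexive (sym (trans (cong H t′≡p) H-start)))))
      locate : (∃ λ i → i ≤ len × at i ≡ s′) → ∃ λ i → i < len × at i ≡ s′ × at (suc i) ≡ t′
      locate (i , i≤l , atᵢ≡s′) = forward i≤l atᵢ≡s′
        (pathNeighbour B B-block B-degree pq∈B path 2≤len i≤l
          (subst (λ x → E B x t′) (sym atᵢ≡s′) (drop∈B D′)))

    weight : Fin n → Fin n → ℕ
    weight s t = 𝟙 (adj? s t) * Δ p q s t

    weight≤ : ∀ s t → weight s t ≤ H s ∸ H t
    weight≤ s t = ≤-trans (*-monoˡ-≤ (Δ p q s t) (𝟙≤1 (adj? s t)))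
      (≤-reflexive (trans (+-identityʳ _) (Δ≡H∸H s t)))

    weight-pq : weight p q ≤ 2
    weight-pq = ≤-trans (weight≤ p q) (≤-trans (m∸n≤m (H p) (H q)) (H≤2 p))

    weight-support : ∀ s t → weight s t ≡ 0 ⊎ ((p , q) ≡ (s , t) ⊎ Drop s t)
    weight-support s t with ≡-dec _≟_ _≟_ (p , q) (s , t) | drop? s t
    ... | yes pq≡st | _         = inj₂ (inj₁ pq≡st)
    ... | no _      | yes drop  = inj₂ (inj₂ drop)
    ... | no pq≢st  | no ¬drop with adj? s t
    ...   | no _   = inj₁ refl
    ...   | yes st = inj₁ (trans (+-identityʳ _) (trans (Δ≡H∸H s t)
      (m≤n⇒m∸n≡0 (≮⇒≥ λ lt → ¬drop (st , lt , pq≢st ∘ sym)))))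

    -- The edge `pq` contributes at most 2. Every other positive term lies on a single path from `p`
    -- to `q`, along which `H` falls by 2 in total.
    local-bound : ∑[ s < n ] ∑[ t < n ] weight s t ≤ 4
    local-bound with any? (λ s → any? λ t → drop? s t)
    ... | no none = begin
      ∑[ s < n ] ∑[ t < n ] weight s t ≤⟨ ∑∑-cover {m = 1} (λ _ → p , q) weight covers ⟩
      weight p q + 0                   ≡⟨ +-identityʳ _ ⟩
      weight p q                       ≤⟨ weight-pq ⟩
      2                                ≤⟨ s≤s (s≤s z≤n) ⟩
      4                                ∎
      where
      open ≤-Reasoning
      covers : ∀ s t → weight s t ≡ 0 ⊎ ∃ λ (i : Fin 1) → (p , q) ≡ (s , t)
      covers s t with weight-support s t
      ... | inj₁ eq           = inj₁ eq
      ... | inj₂ (inj₁ eq)    = inj₂ (zero , eq)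
      ... | inj₂ (inj₂ drop)  = contradiction (s , t , drop) none
    ... | yes (s₀ , t₀ , D) = begin
      ∑[ s < n ] ∑[ t < n ] weight s t
        ≤⟨ ∑∑-cover c weight covers ⟩
      weight p q + ∑[ i < len ] weight (at (toℕ i)) (at (suc (toℕ i)))
        ≤⟨ +-mono-≤ weight-pq (∑-mono-≤ {len} λ i → weight≤ (at (toℕ i)) (at (suc (toℕ i)))) ⟩
      2 + ∑[ i < len ] (H (at (toℕ i)) ∸ H (at (suc (toℕ i))))
        ≡⟨ cong (2 +_) total-drop ⟩
      4 ∎
      where
      open ≤-Reasoning
      open DropPath D
      c : Fin (suc len) → Fin n × Fin n
      c zero    = p , q
      c (suc i) = at (toℕ i) , at (suc (toℕ i))
      covers : ∀ s t → weight s t ≡ 0 ⊎ ∃ λ i → c i ≡ (s , t)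
      covers s t with weight-support s t
      ... | inj₁ eq          = inj₁ eq
      ... | inj₂ (inj₁ eq)   = inj₂ (zero , eq)
      ... | inj₂ (inj₂ drop) = inj₂ (onPath (drop-on-path D drop))
        where
        onPath : (∃ λ i → i < len × at i ≡ s × at (suc i) ≡ t) → ∃ λ i → c i ≡ (s , t)
        onPath (i , i<l , atᵢ≡s , atᵢ₊₁≡t) = suc (fromℕ< i<l) ,
          cong₂ _,_ (trans (cong at (toℕ-fromℕ< i<l)) atᵢ≡s)
                    (trans (cong (at ∘ suc) (toℕ-fromℕ< i<l)) atᵢ₊₁≡t)

    module EvenCycle {k} (C : IsCycle B k) (2∣k : 2 ∣ k) where

      k≡2+a+b : ∀ {s t} → Drop s t → k ≡ suc (suc (d p s + d t q))
      k≡2+a+b D = cycle-length B B-block B-degree pq∈B (DropPath.path D) (DropPath.2≤len D) C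

      -- Here parity enters: in an even cycle every drop lies exactly opposite `pq`.
      midpoint : ∀ {s t} → Drop s t → d p s ≡ d t q
      midpoint {s} {t} D = near-even⇒≡ (d p s) (d t q) a≤1+b b≤1+a (subst (2 ∣_) (k≡2+a+b D) 2∣k)
        where open DropPath D

      same-level : ∀ {s t s′ t′} → Drop s t → Drop s′ t′ → d p s ≡ d p s′
      same-level {s} {t} {s′} {t′} D D′ = *-cancelˡ-≡ (d p s) (d p s′) 2 (+-cancelˡ-≡ 2 _ _ (begin
        2 + 2 * d p s           ≡⟨ twice D ⟩
        k                       ≡⟨ sym (twice D′) ⟩
        2 + 2 * d p s′          ∎))
        where
        open ≡-Reasoning
        twice : ∀ {s t} → Drop s t → 2 + 2 * d p s ≡ k
        twice {s} D = trans
          (cong (λ x → 2 + (d p s + x)) (trans (+-identityʳ _) (midpoint D))) (sym (k≡2+a+b D))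

      -- All drops start at the same distance from `p`, which on the first geodesic equals the
      -- index. On the second geodesic the far end of the step is closer to `q` than `b`, while
      -- `midpoint` would force distance `b`.
      drop-at-a : ∀ {s t} (D : Drop s t) → let open DropPath D in
        ∀ {i} → i < len → Drop (at i) (at (suc i)) → i ≡ a
      drop-at-a D {i} i<l D′ with DropPath.part D (<⇒≤ i<l)
      ... | DropPath.low i≤a    = trans (sym (dist-low i≤a)) (sym (same-level D D′))
        where open DropPath D
      ... | DropPath.high j j≤b = contradiction
        (trans (sym (midpoint D)) (trans (same-level D D′) (trans (midpoint D′) dist-next)))
        (>⇒≢ (≤-trans (≤-reflexive (sym (+-∸-assoc 1 j<b))) (m∸n≤m b j)))
        where
        open DropPath D
        j<b : j < b
        j<b = +-cancelˡ-< (suc a) j b i<l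
        dist-next : d (at (suc (suc (a + j)))) q ≡ b ∸ suc j
        dist-next = trans (cong (λ m → d (at (suc m)) q) (sym (+-suc a j))) (dist-high j<b)

      drop-unique : ∀ {s t s′ t′} → Drop s t → Drop s′ t′ → (s , t) ≡ (s′ , t′)
      drop-unique {s} {t} {s′} {t′} D D′ = located (drop-on-path D D′)
        where
        open DropPath D
        located : (∃ λ i → i < len × at i ≡ s′ × at (suc i) ≡ t′) → (s , t) ≡ (s′ , t′)
        located (i , i<l , atᵢ≡s′ , atᵢ₊₁≡t′) =
          cong₂ _,_ (trans (sym at-a) (trans (cong at (sym i≡a)) atᵢ≡s′))
                    (trans (sym at-1+a) (trans (cong (at ∘ suc) (sym i≡a)) atᵢ₊₁≡t′))
          where i≡a = drop-at-a D i<l (subst₂ Drop (sym atᵢ≡s′) (sym atᵢ₊₁≡t′) D′)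

      -- If H dropped only along pq, it would be constant on B ∖ p and on B ∖ q, which share r.
      drop-exists : ∀ {r} → r ≢ p → r ≢ q → r ∈ V B → ∃₂ λ s t → Drop s t
      drop-exists {r} r≢p r≢q r∈B with any? (λ s → any? λ t → drop? s t)
      ... | yes drop = drop
      ... | no none = case trans (sym Hr≡2) Hr≡0 of λ ()
        where
        flat : ∀ {u v} → E B u v → (u , v) ≢ (p , q) → H u ≤ H v
        flat e ≢pq = ≮⇒≥ λ lt → none (_ , _ , E⊆Adj B e , lt , ≢pq)
        Hr≡0 : H r ≡ 0
        Hr≡0 = conn-closed {P = λ v → H v ≡ 0}
          (λ { Hu≡0 (e , u≢p , v≢p) → n≤0⇒n≡0 (≤-trans
            (flat (E-sym B e) (λ { refl → v≢p refl })) (≤-reflexive Hu≡0)) })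
          (conn-avoiding B (proj₁ B-block) (E⇒∈ʳ B pq∈B) r∈B (p≢q ∘ sym) r≢p) H-end
        Hr≡2 : H r ≡ 2
        Hr≡2 = conn-closed {P = λ v → H v ≡ 2}
          (λ { {u} {v} Hu≡2 (e , u≢q , v≢q) → ≤-antisym (H≤2 v) (≤-trans
            (≤-reflexive (sym Hu≡2)) (flat e (λ { refl → v≢q refl }))) })
          (conn-avoiding B (proj₁ B-block) (E⇒∈ B pq∈B) r∈B p≢q r≢q) H-start

      third-vertex : ∃ λ r → r ≢ p × r ≢ q × r ∈ V B
      third-vertex with any? (λ i → ¬? (vertex i ≟ p) ×-dec ¬? (vertex i ≟ q))
        where open IsCycle C
      ... | yes (i , ≢p , ≢q) = _ , ≢p , ≢q , Equivalence.from (IsCycle.vertices C) (i , refl)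
      ... | no none = contradiction
        (pigeonhole₃ {P = λ i → vertex i ≡ p} {Q = λ i → vertex i ≡ q} same same
          (pOrQ i₀) (pOrQ i₁) (pOrQ i₂)) λ
          { (inj₁ eq)        → case trans (sym (toℕ-fromℕ< _)) (trans (cong toℕ eq) (toℕ-fromℕ< _)) of λ ()
          ; (inj₂ (inj₁ eq)) → case trans (sym (toℕ-fromℕ< _)) (trans (cong toℕ eq) (toℕ-fromℕ< _)) of λ ()
          ; (inj₂ (inj₂ eq)) → case trans (sym (toℕ-fromℕ< _)) (trans (cong toℕ eq) (toℕ-fromℕ< _)) of λ () }
        where
        open IsCycle C
        i₀ i₁ i₂ : Fin k
        i₀ = fromℕ< {0} (≤-trans (s≤s z≤n) 3≤k)
        i₁ = fromℕ< {1} (≤-trans (s≤s (s≤s z≤n)) 3≤k)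
        i₂ = fromℕ< {2} 3≤k
        same : ∀ {x i j} → vertex i ≡ x → vertex j ≡ x → i ≡ j
        same i≡x j≡x = IsCycle.injective C (trans i≡x (sym j≡x))
        pOrQ : ∀ i → vertex i ≡ p ⊎ vertex i ≡ q
        pOrQ i with vertex i ≟ p | vertex i ≟ q
        ... | yes eq | _      = inj₁ eq
        ... | no _   | yes eq = inj₂ eq
        ... | no ≢p  | no ≢q  = contradiction (i , ≢p , ≢q) none

      opposite : ∃₂ λ s t → Drop s t
      opposite = let r , r≢p , r≢q , r∈B = third-vertex in drop-exists r≢p r≢q r∈B

      module _ {s t} (D : Drop s t) where
        open DropPath D

        H-flat : ∀ {i} → i < len → i ≢ a → H (at (suc i)) ≡ H (at i)
        H-flat {i} i<l i≢a = ≤-antisym (H-step i<l) (≮⇒≥ λ lt →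
          i≢a (drop-at-a D i<l (at-adj i<l , lt , ≢pq)))
          where
          -- Were this step `pq` itself, it would run from index 0 to index `len`, forcing `len` to
          -- be 1.
          ≢pq : (at i , at (suc i)) ≢ (p , q)
          ≢pq eq = <⇒≢ 2≤len (trans
            (cong suc (sym (injective (<⇒≤ i<l) z≤n (trans (,-injectiveˡ eq) (sym at-start)))))
            (injective i<l ≤-refl (trans (,-injectiveʳ eq) (sym at-end))))

        H-low : ∀ i → i ≤ a → H (at i) ≡ 2
        H-low zero    _   = trans (cong H at-start) H-start
        H-low (suc i) i<a =
          trans (H-flat (≤-trans i<a (m≤n⇒m≤1+n (m≤m+n a b))) (<⇒≢ i<a)) (H-low i (<⇒≤ i<a))

        H-high : ∀ j {i} → i + j ≡ len → a < i → H (at i) ≡ 0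
        H-high zero    {i} eq _   =
          trans (cong (H ∘ at) (trans (sym (+-identityʳ i)) eq)) (trans (cong H at-end) H-end)
        H-high (suc j) {i} eq a<i = trans
          (sym (H-flat (≤-trans (m≤m+n (suc i) j) (≤-reflexive eq′)) (>⇒≢ a<i)))
          (H-high j eq′ (m≤n⇒m≤1+n a<i))
          where
          eq′ : suc i + j ≡ len
          eq′ = trans (sym (+-suc i j)) eq

        -- `H` is constant along the path except at index `a`, so it falls from 2 to 0 across `st`
        -- alone: `s` is strictly closer to `p` and `t` strictly closer to `q`.
        opposite-separates : Separates p q s t
        opposite-separates = proj₁ D ,
          ≤-reflexive (trans (cong suc (trans (midpoint D) (d-sym t q))) (sym dpt)) ,
          ≤-reflexive (trans (cong suc (trans (d-sym q t) (sym (midpoint D)))) (sym dqs))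
          where
          dpt : d p t ≡ suc (d q t)
          dpt = trans (cong (_+ d p t) (sym (trans (cong H (sym at-1+a)) (H-high b refl ≤-refl)))) (H+d t)
          dqs : d q s ≡ suc (d p s)
          dqs = suc-injective (trans (sym (H+d s))
            (cong (_+ d p s) (trans (cong H (sym at-a)) (H-low a ≤-refl))))

      2≤sep : 2 ≤ sep p q
      2≤sep = let s , t , D = opposite in
        subst (_≤ sep p q)
          (cong₂ _+_ (𝟙-yes (separates? p q s t) (opposite-separates D))
                     (𝟙-yes (separates? p q p q) (self-separates)))
          (∑∑-pair (λ s t → 𝟙 (separates? p q s t)) (proj₂ (proj₂ D)))
        where
        self-separates : Separates p q p q
        self-separates = pq , subst₂ _<_ (sym (d-refl p)) (sym (d-edge pq)) (s≤s z≤n)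
          , subst₂ _<_ (sym (d-refl q)) (sym (d-edge (adj-sym pq))) (s≤s z≤n)

  -- Growth of `sep` along a geodesic

  DropsUnique : Set
  DropsUnique = ∀ {p q} (pq : Adj p q) {s t s′ t′} →
    Edge.Drop pq s t → Edge.Drop pq s′ t′ → (s , t) ≡ (s′ , t′)

  -- By subadditivity some edge of a geodesic from `x` to `y` inherits a positive `Δ`. The
  -- inequality on distances says that `uv` lies on a geodesic, directed towards `y`.
  Δ-edge : ∀ {s t} k x y → d x y ≡ k → 0 < Δ x y s t →
    ∃₂ λ u v → Adj u v × d x u + suc (d v y) ≤ d x y × 0 < Δ u v s t
  Δ-edge {s} {t} zero x y eq Δ>0 with refl ← d≡0⇒≡ eq =
    contradiction (n∸n≡0 (d x s + d x t)) (>⇒≢ Δ>0)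
  Δ-edge {s} {t} (suc k) x y eq Δ>0 with w , xw , wy≡k ← d-step eq with 0 ℕ.<? Δ x w s t
  ... | yes Δxw>0 = x , w , xw ,
    ≤-reflexive (trans (cong (_+ suc (d w y)) (d-refl x)) (trans (cong suc wy≡k) (sym eq))) , Δxw>0
  ... | no Δxw≯0
    with u , v , uv , on-wy , Δuv>0 ← Δ-edge {s} {t} k w y wy≡k (≤-trans Δ>0 (≤-trans
           (Δ-triangle x w y s t) (+-monoˡ-≤ (Δ w y s t) (≮⇒≥ Δxw≯0)))) =
    u , v , uv , on-xy , Δuv>0
    where
    open ≤-Reasoning
    on-xy : d x u + suc (d v y) ≤ d x y
    on-xy = begin
      d x u + suc (d v y)       ≤⟨ +-monoˡ-≤ (suc (d v y)) (d-edgeˡ u xw) ⟩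
      suc (d w u + suc (d v y)) ≤⟨ s≤s on-wy ⟩
      suc (d w y)               ≡⟨ trans (cong suc wy≡k) (sym eq) ⟩
      d x y                     ∎

  module Extension (unique : DropsUnique) {x y y′} (yy′ : Adj y y′) (further : d x y ≡ suc (d x y′)) where

    -- A geodesic from `x` to `y′` through `uv` continues to `y`, so `u` is at distance at least
    -- `d v y′ + 2` from `y`; the positive terms of `Δ` cannot exceed this.
    geodesic-edges-opposed : ∀ {u v} → Adj u v → d x u + suc (d v y′) ≤ d x y′ → Δ u v y y′ ≡ 0
    geodesic-edges-opposed {u} {v} uv on-xy′ = m≤n⇒m∸n≡0 (begin
      d v y + d u y′              ≤⟨ +-mono-≤ (d-edgeʳ v (adj-sym yy′)) (d-edgeˡ y′ uv) ⟩
      suc (d v y′) + suc (d v y′) ≡⟨ cong suc (+-suc (d v y′) (d v y′)) ⟩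
      suc (suc (d v y′)) + d v y′ ≤⟨ +-monoˡ-≤ (d v y′) far ⟩
      d u y + d v y′              ∎)
      where
      open ≤-Reasoning
      far : suc (suc (d v y′)) ≤ d u y
      far = +-cancelˡ-≤ (d x u) _ _ (begin
        d x u + suc (suc (d v y′)) ≡⟨ +-suc (d x u) (suc (d v y′)) ⟩
        suc (d x u + suc (d v y′)) ≤⟨ s≤s on-xy′ ⟩
        suc (d x y′)               ≡⟨ sym further ⟩
        d x y                      ≤⟨ d-triangle x u y ⟩
        d x u + d u y              ∎)

    -- Otherwise a geodesic edge uv and yy′ would both be drops relative to st.  They are distinct,
    -- so one of them is st itself, and then the other is not a drop.
    no-return : ∀ {s t} → Adj s t → 0 < Δ x y′ s t → Δ y y′ s t ≡ 0
    no-return {s} {t} st Δ>0 = n≤0⇒n≡0 (≮⇒≥ λ Δyy′>0 → go Δyy′>0 (Δ-edge (d x y′) x y′ refl Δ>0))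
      where
      go : 0 < Δ y y′ s t →
        ¬ (∃₂ λ u v → Adj u v × d x u + suc (d v y′) ≤ d x y′ × 0 < Δ u v s t)
      go Δyy′>0 (u , v , uv , on-xy′ , Δuv>0)
        with ≡-dec _≟_ _≟_ (u , v) (s , t) | ≡-dec _≟_ _≟_ (y , y′) (s , t)
      ... | yes refl | _ = >⇒≢ Δyy′>0
        (trans (Δ-symmetric y y′ u v) (geodesic-edges-opposed uv on-xy′))
      ... | no _ | yes refl = >⇒≢ Δuv>0 (geodesic-edges-opposed uv on-xy′)
      ... | no uv≢st | no yy′≢st = <-irrefl refl (begin-strict
        d x y′              <⟨ n<1+n _ ⟩
        suc (d x y′)        ≡⟨ sym further ⟩
        d x y               ≡⟨ cong (d x) (sym u≡y) ⟩
        d x u               ≤⟨ m≤m+n _ _ ⟩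
        d x u + suc (d v y′) ≤⟨ on-xy′ ⟩
        d x y′              ∎)
        where
        open ≤-Reasoning
        open Edge st
        u≡y : u ≡ y
        u≡y = ,-injectiveˡ (unique st
          (0<Δ⇒drop uv (subst (0 <_) (Δ-symmetric u v s t) Δuv>0) uv≢st)
          (0<Δ⇒drop yy′ (subst (0 <_) (Δ-symmetric y y′ s t) Δyy′>0) yy′≢st))

    -- By `no-return`, an edge separating the ends of one part is not crossed back on the other
    -- part, so it separates `x` and `y`. No edge counts twice, since the two conditions at `y′`
    -- contradict each other.
    sep-superadditive : sep x y′ + sep y′ y ≤ sep x y
    sep-superadditive = begin
      sep x y′ + sep y′ y
        ≡⟨ sym (∑-distrib-+ (λ s → ∑[ t < n ] 𝟙 (separates? x y′ s t)) (λ s → ∑[ t < n ] 𝟙 (separates? y′ y s t))) ⟩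
      ∑[ s < n ] (∑[ t < n ] 𝟙 (separates? x y′ s t) + ∑[ t < n ] 𝟙 (separates? y′ y s t))
        ≡⟨ sum-cong-≗ (λ s → sym (∑-distrib-+ (λ t → 𝟙 (separates? x y′ s t)) (λ t → 𝟙 (separates? y′ y s t)))) ⟩
      ∑[ s < n ] ∑[ t < n ] (𝟙 (separates? x y′ s t) + 𝟙 (separates? y′ y s t))
        ≤⟨ ∑-mono-≤ (λ s → ∑-mono-≤ λ t →
             𝟙-disjoint (separates? x y′ s t) (separates? y′ y s t) (separates? x y s t) first second disjoint) ⟩
      sep x y ∎
      where
      open ≤-Reasoning
      𝟙-disjoint : ∀ {A B C : Set} (a? : Dec A) (b? : Dec B) (c? : Dec C) →
        (A → C) → (B → C) → (A → B → ⊥) → 𝟙 a? + 𝟙 b? ≤ 𝟙 c?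
      𝟙-disjoint (yes a) (yes b) c? _ _ ab = ⊥-elim (ab a b)
      𝟙-disjoint (yes a) (no _)  c? f _ _  = ≤-reflexive (sym (𝟙-yes c? (f a)))
      𝟙-disjoint (no _)  b?      c? _ g _  = 𝟙-mono b? c? g
      positive : ∀ {x y s t} → Separates x y s t → 0 < Δ x y s t
      positive S = ≤-trans (s≤s z≤n) (Separates⇒2≤Δ S)
      transfer : ∀ {a b c e} → a + b ≤ c + e → e < a → b < c
      transfer {a} {b} {c} {e} le e<a = +-cancelˡ-< a b c
        (≤-<-trans le (<-≤-trans (+-monoʳ-< c e<a) (≤-reflexive (+-comm c a))))
      first : ∀ {s t} → Separates x y′ s t → Separates x y s t
      first S@(st , xs<xt , y′t<y′s) =
        st , xs<xt , transfer (m∸n≡0⇒m≤n (no-return st (positive S))) y′t<y′s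
      second : ∀ {s t} → Separates y′ y s t → Separates x y s t
      second {s} {t} (st , y′s<y′t , yt<ys) = st , transfer (m∸n≡0⇒m≤n Δ≡0) y′s<y′t , yt<ys
        where
        -- Reversed, the edge separates `y` from `y′`, so `no-return` for `ts` excludes a positive
        -- value on the part from `x` to `y′`.
        Δ≡0 : Δ x y′ t s ≡ 0
        Δ≡0 = n≤0⇒n≡0 (≮⇒≥ λ Δ>0 →
          >⇒≢ (positive (adj-sym st , yt<ys , y′s<y′t)) (no-return (adj-sym st) Δ>0))
      disjoint : ∀ {s t} → Separates x y′ s t → Separates y′ y s t → ⊥
      disjoint (_ , _ , y′t<y′s) (_ , y′s<y′t , _) = <-asym y′t<y′s y′s<y′t

  block-edge : ∀ (B : Subgraph G) → TwoConnected B → ∃₂ λ p q → E B p q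
  block-edge B (_ , ((u , u∈) , B-conn) , B∖-conn)
    with v , v∈ ← proj₁ (B∖-conn u∈)
    with B-conn u∈ (p─q⊆p _ _ v∈)
  ... | zero  , refl      = contradiction refl (x∈p-y⇒x≢y (V B) v∈)
  ... | suc _ , w , e , _ = u , w , e

  -- Double counting: both indices as sums over ordered pairs of vertices

  2*Sz≡∑∑sep : 2 * Sz G ≡ ∑[ x < n ] ∑[ y < n ] sep x y
  2*Sz≡∑∑sep = begin
    2 * Sz G
      ≡⟨ cong (2 *_) (sum-cong-≗ λ s → sum-cong-≗ λ t → trans
           (cong (_* (closer G s t * closer G t s)) (𝟙-× (s <? t) (adj? s t))) (*-assoc (𝟙 (s <? t)) _ _)) ⟩
    2 * ∑[ s < n ] ∑[ t < n ] (𝟙 (s <? t) * F s t)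
      ≡⟨ ∑∑-symmetric F F-sym F-diag ⟩
    ∑[ s < n ] ∑[ t < n ] F s t
      ≡⟨ sum-cong-≗ (λ s → sum-cong-≗ λ t → expand s t) ⟩
    ∑[ s < n ] ∑[ t < n ] ∑[ x < n ] ∑[ y < n ] 𝟙 (separates? x y s t)
      ≡⟨ ∑-comm₄ (λ s t x y → 𝟙 (separates? x y s t)) ⟩
    ∑[ x < n ] ∑[ y < n ] sep x y ∎
    where
    open ≡-Reasoning
    F : Fin n → Fin n → ℕ
    F s t = 𝟙 (adj? s t) * (closer G s t * closer G t s)
    F-sym : ∀ s t → F s t ≡ F t s
    F-sym s t = cong₂ _*_
      (≤-antisym (𝟙-mono (adj? s t) (adj? t s) adj-sym) (𝟙-mono (adj? t s) (adj? s t) adj-sym))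
      (*-comm (closer G s t) (closer G t s))
    F-diag : ∀ s → F s s ≡ 0
    F-diag s rewrite 𝟙-no (adj? s s) (adj-irrefl refl) = refl
    expand : ∀ s t → F s t ≡ ∑[ x < n ] ∑[ y < n ] 𝟙 (separates? x y s t)
    expand s t = begin
      𝟙 (adj? s t) * (closer G s t * closer G t s)
        ≡⟨ cong (𝟙 (adj? s t) *_) (*-distribʳ-sum (closer G t s) left) ⟩
      𝟙 (adj? s t) * ∑[ x < n ] (left x * closer G t s)
        ≡⟨ *-distribˡ-sum (𝟙 (adj? s t)) (λ x → left x * closer G t s) ⟩
      ∑[ x < n ] (𝟙 (adj? s t) * (left x * closer G t s))
        ≡⟨ sum-cong-≗ (λ x → trans (cong (𝟙 (adj? s t) *_) (*-distribˡ-sum (left x) right))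
             (*-distribˡ-sum (𝟙 (adj? s t)) (λ y → left x * right y))) ⟩
      ∑[ x < n ] ∑[ y < n ] (𝟙 (adj? s t) * (left x * right y))
        ≡⟨ sum-cong-≗ (λ x → sum-cong-≗ λ y → sym (trans
             (𝟙-× (adj? s t) ((d x s ℕ.<? d x t) ×-dec (d y t ℕ.<? d y s)))
             (cong (𝟙 (adj? s t) *_) (𝟙-× (d x s ℕ.<? d x t) (d y t ℕ.<? d y s))))) ⟩
      ∑[ x < n ] ∑[ y < n ] 𝟙 (separates? x y s t) ∎
      where
      left right : Fin n → ℕ
      left x = 𝟙 (d x s ℕ.<? d x t)
      right y = 𝟙 (d y t ℕ.<? d y s)

  2*W≡∑∑d : 2 * W G ≡ ∑[ x < n ] ∑[ y < n ] d x y
  2*W≡∑∑d = ∑∑-symmetric d d-sym d-refl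

  2*2*W≡∑∑2*d : 2 * (2 * W G) ≡ ∑[ x < n ] ∑[ y < n ] (2 * d x y)
  2*2*W≡∑∑2*d = trans (cong (2 *_) 2*W≡∑∑d) (trans
    (*-distribˡ-sum 2 (λ x → ∑[ y < n ] d x y)) (sum-cong-≗ λ x → *-distribˡ-sum 2 (d x)))

  -- The inequality and the equality case

  module _ (block-degree : ∀ (B : Subgraph G) → IsBlock B → DegreeAtMostTwo B) where

    ¬¬block-of : ∀ {p q} → Adj p q → ¬ ¬ (∃ λ (B : Subgraph G) → IsBlock B × E B p q)
    ¬¬block-of pq none = ¬¬block (edgeSubgraph pq) (edgeSubgraph-twoConnected {G = G} pq)
      λ (B , B-block , _ , pq⊆B) → none (B , B-block , pq⊆B (inj₁ (refl , refl)))

    variation : Fin n → Fin n → ℕ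
    variation x y = ∑[ s < n ] ∑[ t < n ] (𝟙 (adj? s t) * Δ x y s t)

    edge-variation≤4 : ∀ {p q} → Adj p q → variation p q ≤ 4
    edge-variation≤4 pq = decidable-stable (_ ≤? 4) λ ¬≤4 → ¬¬block-of pq
      λ (B , B-block , pq∈B) → ¬≤4 (InBlock.local-bound pq B B-block (block-degree B B-block) pq∈B)

    variation-triangle : ∀ x z y → variation x y ≤ variation x z + variation z y
    variation-triangle x z y = begin
      variation x y
        ≤⟨ ∑-mono-≤ (λ s → ∑-mono-≤ λ t → ≤-trans
             (*-monoʳ-≤ (𝟙 (adj? s t)) (Δ-triangle x z y s t)) (≤-reflexive (*-distribˡ-+ (𝟙 (adj? s t)) _ _))) ⟩
      ∑[ s < n ] ∑[ t < n ] (K x z s t + K z y s t)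
        ≡⟨ sum-cong-≗ (λ s → ∑-distrib-+ (K x z s) (K z y s)) ⟩
      ∑[ s < n ] (∑[ t < n ] K x z s t + ∑[ t < n ] K z y s t)
        ≡⟨ ∑-distrib-+ (λ s → ∑[ t < n ] K x z s t) (λ s → ∑[ t < n ] K z y s t) ⟩
      variation x z + variation z y ∎
      where
      open ≤-Reasoning
      K : Fin n → Fin n → Fin n → Fin n → ℕ
      K x y s t = 𝟙 (adj? s t) * Δ x y s t

    variation≤4*d : ∀ k x y → d x y ≡ k → variation x y ≤ 4 * k
    variation≤4*d zero x y eq with refl ← d≡0⇒≡ eq = begin
      variation x x
        ≡⟨ sum-cong-≗ (λ s → sum-cong-≗ λ t → trans
             (cong (𝟙 (adj? s t) *_) (n∸n≡0 (d x s + d x t))) (*-zeroʳ (𝟙 (adj? s t)))) ⟩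
      ∑[ s < n ] ∑[ t < n ] 0
        ≡⟨ sum-cong-≗ {n} (λ s → sum-replicate-zero n) ⟩
      ∑[ s < n ] 0
        ≡⟨ sum-replicate-zero n ⟩
      0 ∎
      where open ≤-Reasoning
    variation≤4*d (suc k) x y eq with w , xw , wy≡k ← d-step eq = begin
      variation x y                 ≤⟨ variation-triangle x w y ⟩
      variation x w + variation w y ≤⟨ +-mono-≤ (edge-variation≤4 xw) (variation≤4*d k w y wy≡k) ⟩
      4 + 4 * k                     ≡⟨ sym (*-suc 4 k) ⟩
      4 * suc k                     ∎
      where open ≤-Reasoning

    2*sep≤variation : ∀ x y → 2 * sep x y ≤ variation x y
    2*sep≤variation x y = begin
      2 * sep x y
        ≡⟨ *-distribˡ-sum 2 (λ s → ∑[ t < n ] 𝟙 (separates? x y s t)) ⟩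
      ∑[ s < n ] (2 * ∑[ t < n ] 𝟙 (separates? x y s t))
        ≡⟨ sum-cong-≗ (λ s → *-distribˡ-sum 2 (λ t → 𝟙 (separates? x y s t))) ⟩
      ∑[ s < n ] ∑[ t < n ] (2 * 𝟙 (separates? x y s t))
        ≤⟨ ∑-mono-≤ (λ s → ∑-mono-≤ (pointwise s)) ⟩
      variation x y ∎
      where
      open ≤-Reasoning
      pointwise : ∀ s t → 2 * 𝟙 (separates? x y s t) ≤ 𝟙 (adj? s t) * Δ x y s t
      pointwise s t = case separates? x y s t of λ
        { (yes S) → subst₂ (λ i j → 2 * i ≤ j * Δ x y s t)
            (sym (𝟙-yes (separates? x y s t) S)) (sym (𝟙-yes (adj? s t) (proj₁ S)))
            (≤-trans (Separates⇒2≤Δ S) (m≤m+n _ 0))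
        ; (no ¬S) → subst (λ i → 2 * i ≤ 𝟙 (adj? s t) * Δ x y s t) (sym (𝟙-no (separates? x y s t) ¬S)) z≤n }

    sep≤2*d : ∀ x y → sep x y ≤ 2 * d x y
    sep≤2*d x y = *-cancelˡ-≤ 2 (≤-trans (2*sep≤variation x y)
      (≤-trans (variation≤4*d (d x y) x y refl) (≤-reflexive (*-assoc 2 2 (d x y)))))

    Sz≤2*W : Sz G ≤ 2 * W G
    Sz≤2*W = *-cancelˡ-≤ 2 (begin
      2 * Sz G                              ≡⟨ 2*Sz≡∑∑sep ⟩
      ∑[ x < n ] ∑[ y < n ] sep x y         ≤⟨ ∑-mono-≤ (λ x → ∑-mono-≤ (sep≤2*d x)) ⟩
      ∑[ x < n ] ∑[ y < n ] (2 * d x y)     ≡⟨ sym 2*2*W≡∑∑2*d ⟩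
      2 * (2 * W G)                         ∎)
      where open ≤-Reasoning

    -- Equal totals of termwise ordered sums force equality in every term.
    equality⇒sep≡2*d : Sz G ≡ 2 * W G → ∀ x y → sep x y ≡ 2 * d x y
    equality⇒sep≡2*d eq x = ∑-mono-≤-equality (sep≤2*d x)
      (∑-mono-≤-equality (λ x → ∑-mono-≤ (sep≤2*d x))
        (trans (sym 2*Sz≡∑∑sep) (trans (cong (2 *_) eq) 2*2*W≡∑∑2*d)) x)

    -- If `(p , q)` were the only separating edge, the sum would be at most 1.
    sep≡2⇒separator : ∀ {p q} → sep p q ≡ 2 → ∃₂ λ s t → Separates p q s t × (s , t) ≢ (p , q)
    sep≡2⇒separator {p} {q} sep≡2
      with any? (λ s → any? λ t → separates? p q s t ×-dec ¬? (≡-dec _≟_ _≟_ (s , t) (p , q)))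
    ... | yes found = found
    ... | no none   = contradiction (begin
      2                              ≡⟨ sym sep≡2 ⟩
      sep p q                        ≤⟨ ∑∑-cover {m = 1} (λ _ → p , q) _ covers ⟩
      𝟙 (separates? p q p q) + 0     ≤⟨ +-monoˡ-≤ 0 (𝟙≤1 (separates? p q p q)) ⟩
      1                              ∎) (<⇒≱ ≤-refl)
      where
      open ≤-Reasoning
      covers : ∀ s t → 𝟙 (separates? p q s t) ≡ 0 ⊎ ∃ λ (i : Fin 1) → (p , q) ≡ (s , t)
      covers s t = case ≡-dec _≟_ _≟_ (s , t) (p , q) of λ
        { (yes eq) → inj₂ (zero , sym eq)
        ; (no neq) → inj₁ (𝟙-no (separates? p q s t) λ S → none (s , t , S , neq)) }

    equality⇒even : Sz G ≡ 2 * W G →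
      ∀ (B : Subgraph G) → IsBlock B → IsEdge B ⊎ (∃ λ k → IsCycle B k) → IsEvenCycle B
    equality⇒even eq B B-block kind = go (block-edge B (proj₁ B-block))
      where
      go : (∃₂ λ p q → E B p q) → IsEvenCycle B
      go (p , q , pq∈B) = separated (sep≡2⇒separator
        (trans (equality⇒sep≡2*d eq p q) (cong (2 *_) (d-edge pq))))
        where
        pq = E⊆Adj B pq∈B
        open Edge pq
        separated : (∃₂ λ s t → Separates p q s t × (s , t) ≢ (p , q)) → IsEvenCycle B
        separated (s , t , S@(st , ps<pt , qt<qs) , ≢pq) = even kind
          where
          D : Drop s t
          D = 0<Δ⇒drop st (≤-trans (s≤s z≤n) (Separates⇒2≤Δ S)) ≢pq
          open DropPath D
          degree = block-degree B B-block
          -- `d p s < d p t ≤ suc (d q t)` and, symmetrically, `d q t < d q s ≤ suc (d p s)`, so the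
          -- two distances agree and the cycle has length `2 * suc a`.
          a≡b : a ≡ b
          a≡b = trans
            (≤-antisym (s≤s⁻¹ (≤-trans ps<pt (d-edgeˡ t pq))) (s≤s⁻¹ (≤-trans qt<qs (d-edgeˡ s (adj-sym pq)))))
            (d-sym q t)
          even : IsEdge B ⊎ (∃ λ k → IsCycle B k) → IsEvenCycle B
          even (inj₂ (k , C)) = k , C , divides (suc a) (trans
            (cycle-length B B-block degree pq∈B path 2≤len C)
            (trans (cong (λ x → suc (suc (a + x))) (sym a≡b)) (double a)))
            where
            double : ∀ a → suc (suc (a + a)) ≡ suc a * 2
            double = solve-∀
          -- A single edge cannot contain the three distinct path vertices at indices 0, 1 and
          -- `len`.
          even (inj₁ (u , v , _ , ends)) = contradiction
            (pigeonhole₃ (λ x y → trans x (sym y)) (λ x y → trans x (sym y))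
              (ends (at∈ z≤n)) (ends (at∈ (<⇒≤ 2≤len))) (ends (at∈ 2≤len)))
            λ { (inj₁ e)        → case injective z≤n (<⇒≤ 2≤len) e of λ ()
              ; (inj₂ (inj₁ e)) → case injective z≤n 2≤len e of λ ()
              ; (inj₂ (inj₂ e)) → case injective (<⇒≤ 2≤len) 2≤len e of λ () }
            where
            at∈ : ∀ {i} → i ≤ len → at i ∈ V B
            at∈ = at∈B B B-block degree pq∈B path 2≤len

    module _ (even : ∀ (B : Subgraph G) → IsBlock B → IsEvenCycle B) where

      drops-unique : DropsUnique
      drops-unique pq {s} {t} {s′} {t′} D D′ =
        decidable-stable (≡-dec _≟_ _≟_ (s , t) (s′ , t′)) λ ≢ → ¬¬block-of pq
          λ (B , B-block , pq∈B) → let k , C , 2∣k = even B B-block in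
            ≢ (InBlock.EvenCycle.drop-unique pq B B-block (block-degree B B-block) pq∈B C 2∣k D D′)

      2≤sep-edge : ∀ {p q} → Adj p q → 2 ≤ sep p q
      2≤sep-edge {p} {q} pq = decidable-stable (2 ≤? sep p q) λ ≰ → ¬¬block-of pq
        λ (B , B-block , pq∈B) → let k , C , 2∣k = even B B-block in
          ≰ (InBlock.EvenCycle.2≤sep pq B B-block (block-degree B B-block) pq∈B C 2∣k)

      -- Each step of a geodesic adds at least 2. The induction shortens the geodesic at `y`, and as
      -- `d-step` moves its first argument, the distance is read as `d y x`.
      2*d≤sep : ∀ k x y → d y x ≡ k → 2 * k ≤ sep x y
      2*d≤sep zero    x y eq = z≤n
      2*d≤sep (suc k) x y eq with y′ , yy′ , y′x≡k ← d-step eq = begin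
        2 * suc k           ≡⟨ trans (*-suc 2 k) (+-comm 2 (2 * k)) ⟩
        2 * k + 2           ≤⟨ +-mono-≤ (2*d≤sep k x y′ y′x≡k) (2≤sep-edge (adj-sym yy′)) ⟩
        sep x y′ + sep y′ y ≤⟨ Extension.sep-superadditive drops-unique yy′ further ⟩
        sep x y             ∎
        where
        open ≤-Reasoning
        further : d x y ≡ suc (d x y′)
        further = trans (d-sym x y) (trans eq (cong suc (trans (sym y′x≡k) (d-sym y′ x))))

      even⇒equality : Sz G ≡ 2 * W G
      even⇒equality = ≤-antisym Sz≤2*W (*-cancelˡ-≤ 2 (begin
        2 * (2 * W G)                         ≡⟨ 2*2*W≡∑∑2*d ⟩
        ∑[ x < n ] ∑[ y < n ] (2 * d x y)     ≤⟨ ∑-mono-≤ (λ x → ∑-mono-≤ λ y → 2*d≤sep′ x y) ⟩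
        ∑[ x < n ] ∑[ y < n ] sep x y         ≡⟨ sym 2*Sz≡∑∑sep ⟩
        2 * Sz G                              ∎))
        where
        open ≤-Reasoning
        2*d≤sep′ : ∀ x y → 2 * d x y ≤ sep x y
        2*d≤sep′ x y = subst (λ k → 2 * k ≤ sep x y) (d-sym y x) (2*d≤sep (d y x) x y refl)

-- On a single vertex there are no blocks, as a block has at least two vertices.
block-kind : (G : Graph n) → Cactus G → (B : Subgraph G) → IsBlock B →
  IsEdge B ⊎ ∃ λ k → IsCycle B k
block-kind G (_ , inj₂ kinds) B B-block = kinds B B-block
block-kind G (_ , inj₁ refl) B ((2≤∣V∣ , _) , _) =
  contradiction (∣p∣≤n (Subgraph.V B)) (<⇒≱ 2≤∣V∣)

theorem3p1 : (n : ℕ) (G : Graph n) → Cactus G →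
    (Sz G ≤ 2 * W G) ×
    (Sz G ≡ 2 * W G ⇔ ((B : Subgraph G) → IsBlock B → IsEvenCycle B))
theorem3p1 n G cactus =
  Sz≤2*W G connected degree ,
  mk⇔ (λ eq B B-block → equality⇒even G connected degree eq B B-block (block-kind G cactus B B-block))
      (even⇒equality G connected degree)
  where
  connected : Connected (whole G)
  connected = proj₁ cactus
  degree : ∀ (B : Subgraph G) → IsBlock B → DegreeAtMostTwo B
  degree B B-block = [ edge-degree B , (λ (_ , C) → cycle-degree B C) ]′ (block-kind G cactus B B-block)
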